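{- Let $1\le k<n$ be integers with $n>T(k)$. Then $m(1,J(n,k))\ge N(n,k)+1$.
   Context: $J(n,k)$ is the Johnson graph on the $k$-subsets of $\{1,\dots,n\}$ (adjacent iff they meet in $k-1$ elements); $\theta_1(J(n,k))=(k-1)(n-k-1)-1$ is its second largest eigenvalue. NZI means all entries nonzero integers; $m(1,J(n,k))=\min\{\|v\|_\infty+1: v\text{ an NZI }\theta_1(J(n,k))\text{ -eigenvector}\}$. $(x,y)$ denotes $\gcd(x,y)$. Let $\gamma$ be the smallest positive integer not dividing $k$, and set $j=2k$ if $k$ is odd and $j=(\lfloor\gamma/2\rfloor+1)(2k+\gamma)$ if $k$ is even; $T(k)=j^2+2kj+3k-j-\frac{j^2}{k}$. $B(n,k)$ is the set of quadruples $(a,b,r,s)$ of non-negative integers with $b\ne0$, $0\le r<s$, $(s,r)=1$, $s$ dividing $(n,k)$, and $\frac{(bs-r)k}{s(a+b)}$ not an integer. $N(n,k)=\min\{\max\{k(a+\frac rs),\,k(b-\frac rs)\}:(a,b,r,s)\in B(n,k)\}$. -}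

module Defs where

open import Data.Nat as ℕ using (ℕ; zero; suc; _∸_)
open import Data.Nat.Divisibility using (_∣_)
open import Data.Nat.DivMod using (_/_; _%_)
open import Data.Nat.GCD using (gcd)
open import Data.Integer as ℤ using (ℤ; +_)
open import Data.Rational as ℚ using (ℚ)
open import Data.Fin.Subset using (Subset; inside; outside; ∣_∣; _∩_)
open import Data.List using (List; []; _∷_; _++_; map; filter; foldr)
open import Data.Vec using (_∷_; [])
open import Data.Product using (_×_; ∃; Σ)
open import Relation.Nullary using (¬_)
open import Relation.Binary.PropositionalEquality using (_≡_; _≢_)

ℕtoℚ : ℕ → ℚ
ℕtoℚ m = (+ m) ℚ./ 1

-- p / d as a rational; only ever used with d > 0 (the value at d = 0 is
-- an irrelevant convention).
frac : ℕ → ℕ → ℚ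
frac p zero    = ℚ.0ℚ
frac p (suc d) = (+ p) ℚ./ suc d

IsLeastNonDivisor : ℕ → ℕ → Set
IsLeastNonDivisor k γ =
  (0 ℕ.< γ) × (¬ (γ ∣ k)) × (∀ d → 0 ℕ.< d → d ℕ.< γ → d ∣ k)

jval : ℕ → ℕ → ℕ
jval k γ with k % 2
... | zero  = (γ / 2 ℕ.+ 1) ℕ.* (2 ℕ.* k ℕ.+ γ)
... | suc _ = 2 ℕ.* k

T : ℕ → ℕ → ℚ
T k γ = ℕtoℚ (j ℕ.* j ℕ.+ 2 ℕ.* k ℕ.* j ℕ.+ 3 ℕ.* k)
        ℚ.- ℕtoℚ j ℚ.- frac (j ℕ.* j) k
  where j = jval k γ

-- (a,b,r,s) ∈ B(n,k).  "(bs−r)k / (s(a+b)) is not an integer" is written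
-- as non-divisibility of the (non-negative, since bs ≥ s > r) numerator by
-- the positive denominator.
InB : ℕ → ℕ → ℕ → ℕ → ℕ → ℕ → Set
InB n k a b r s =
  (b ≢ 0) × (r ℕ.< s) × (gcd s r ≡ 1) × (s ∣ gcd n k)
  × ¬ ((s ℕ.* (a ℕ.+ b)) ∣ ((b ℕ.* s ∸ r) ℕ.* k))

valB : ℕ → ℕ → ℕ → ℕ → ℕ → ℚ
valB k a b r s =
  (ℕtoℚ k ℚ.* (ℕtoℚ a ℚ.+ frac r s)) ℚ.⊔ (ℕtoℚ k ℚ.* (ℕtoℚ b ℚ.- frac r s))

IsMinN : ℕ → ℕ → ℚ → Set
IsMinN n k N =
  (∃ λ a → ∃ λ b → ∃ λ r → ∃ λ s → InB n k a b r s × valB k a b r s ≡ N)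
  × (∀ a b r s → InB n k a b r s → N ℚ.≤ valB k a b r s)

allSubsets : (n : ℕ) → List (Subset n)
allSubsets zero    = [] ∷ []
allSubsets (suc n) = map (inside ∷_) (allSubsets n) ++ map (outside ∷_) (allSubsets n)

kSubsets : (n k : ℕ) → List (Subset n)
kSubsets n k = filter (λ p → ∣ p ∣ ℕ.≟ k) (allSubsets n)

neighbours : (n k : ℕ) → Subset n → List (Subset n)
neighbours n k p = filter (λ q → ∣ p ∩ q ∣ ℕ.≟ k ∸ 1) (kSubsets n k)

sumℤ : List ℤ → ℤ
sumℤ = foldr ℤ._+_ (+ 0)

θ₁ : ℕ → ℕ → ℤ
θ₁ n k = ((+ k) ℤ.- + 1) ℤ.* ((+ n) ℤ.- (+ k) ℤ.- + 1) ℤ.- + 1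

-- v (a function on vertices; values off k-subsets are irrelevant) is an
-- NZI θ₁(J(n,k))-eigenvector of the adjacency matrix
IsNZIθ₁Eigenvector : (n k : ℕ) → (Subset n → ℤ) → Set
IsNZIθ₁Eigenvector n k v =
  (∀ p → ∣ p ∣ ≡ k → v p ≢ + 0)
  × (∀ p → ∣ p ∣ ≡ k → sumℤ (map v (neighbours n k p)) ≡ θ₁ n k ℤ.* v p)

supNorm : (n k : ℕ) → (Subset n → ℤ) → ℕ
supNorm n k v = foldr ℕ._⊔_ 0 (map (λ p → ℤ.∣ v p ∣) (kSubsets n k))

{-# OPTIONS --safe #-}

-- The eigenvalue equations at p ∪ {x} and p ∪ {y} subtract to say that
-- v (p ∪ {x}) − v (p ∪ {y}) is an eigenvector of J(n−2, k−1) for its degree, hence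
-- constant by the maximum principle.  So v p = q + Σ_{x ∈ p} c x with integral c,
-- 0 ≤ q < k and n q + k Σ c = 0.  The weights q / k + c x sum to 0, so if ‖v‖∞ < k M
-- and n > T(k), then pigeonhole gives k equal weights a + r/s ≥ 0 and k equal weights
-- − (b − r/s) < 0, where r/s = q/k.  Choosing the k-subset among those 2k points shows
-- that v has no zero only if (a, b, r, s) ∈ B(n, k), and ‖v‖∞ is at least its value.
-- If instead ‖v‖∞ ≥ k M, an explicit quadruple with r = 0 and a, b ≤ M suffices.
module Submission where

open import Defs
open import Data.Nat as ℕ using (ℕ; zero; suc; _∸_)
import Data.Nat.DivMod as ℕ
import Data.Nat.Properties as ℕ
import Data.Nat.Tactic.RingSolver as ℕ
open import Data.Nat.Coprimality using (coprime-/gcd; coprime⇒gcd≡1; coprime-divisor)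
open import Data.Nat.Divisibility using (_∣_; divides; 1∣_; ∣m+n∣m⇒∣n; ∣n⇒∣m*n; m%n≡0⇒n∣m; n∣m⇒m%n≡0)
open import Data.Nat.GCD using (gcd; gcd-greatest; gcd[m,n]∣m; gcd[m,n]∣n; gcd[m,n]≢0)
open import Data.Integer using (ℤ; +_; -[1+_]; +≤+; -≤-; +<+; 0ℤ; 1ℤ; _+_; _*_; _-_; -_; _≤_; _<_)
import Data.Integer.Base as ℤ using (∣_∣)
open import Data.Integer.DivMod using (_/ℕ_; _%ℕ_; n%ℕd<d; a≡a%ℕn+[a/ℕn]*n)
import Data.Integer.Properties as ℤ
open import Data.Integer.Tactic.RingSolver using (solve-∀)
open import Data.Rational as ℚ using (ℚ)
import Data.Rational.Properties as ℚ
import Data.Rational.Solver as ℚ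
import Data.Rational.Unnormalised as ℚᵘ
import Data.Rational.Unnormalised.Properties as ℚᵘ
open import Data.Bool using (true; false)
open import Data.Empty using (⊥; ⊥-elim)
open import Data.Fin using (Fin; zero; suc)
open import Data.Fin.Subset using (Subset; inside; outside; ∣_∣; _∩_) renaming (⊤ to full)
open import Data.Fin.Subset.Properties using (p∩q⊆p; p∩q⊆q; p⊆q⇒∣p∣≤∣q∣; ∣p∣≤n; ∣⊤∣≡n)
open import Data.List using (List; []; _∷_; _++_; map; filter; foldr; length)
import Data.List.Properties as List
open import Data.List.Extrema ℤ.≤-totalOrder using (argmax; argmax-all; f[xs]≤f[argmax])
open import Data.List.Membership.Propositional using (_∈_)
open import Data.List.Membership.Propositional.Properties
  using (∈-map⁺; ∈-map⁻; ∈-++⁺ˡ; ∈-++⁺ʳ; ∈-++⁻; ∈-filter⁻)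
open import Data.List.Relation.Unary.All as All using (All; []; _∷_)
import Data.List.Relation.Unary.All.Properties as All
open import Data.List.Relation.Unary.Any using (here; there)
open import Data.Product using (_×_; _,_; ∃; ∃₂; proj₁; proj₂)
open import Data.Sum using (_⊎_; inj₁; inj₂)
open import Data.Vec as Vec using (Vec; []; _∷_; lookup; insertAt; tabulate)
open import Data.Vec.Properties using (lookup∘tabulate)
open import Function using (_∘_)
open import Relation.Nullary using (¬_; does; yes; no)
open import Relation.Unary using (Decidable)
open import Relation.Binary.PropositionalEquality

-- The vertices p ∪ {x} and p ∪ {y} are adjacent, so each occurs in the neighbour sum of the other;
-- subtracting the two equations therefore raises the eigenvalue by 1, to θ₁ + 1 = (k - 1)(n - k -
-- 1), which is the degree of J(n-2, k-1). The size of n enters through integrality: as q < k, a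
-- coordinate with c x < 0 has q + k c x ≤ - 1, so the negative coordinates cannot be numerous
-- unless the nonnegative part of the zero sum is large. With ‖v‖∞ < k M and no frequent value in
-- [0, M), that part is bounded by k and M alone, with leading term k (k - 1) M². The negative side
-- is the same argument for - v. Multiplicity k is what is needed, because every mixture of i points
-- of slope a and k - i points of slope - b must be available: the values along these mixtures move
-- in steps of a + b, and avoiding 0 is the divisibility condition of B(n,k). M is any number for
-- which N(n,k) ≤ k M is evident. If a + b divides k it divides b k, so a usable sum a + b is a
-- non-divisor of k and hence at least γ; the explicit quadruples have a + b = γ with a and b close
-- to γ/2. This is how γ enters j.

private variable A B : Set

-- Linear consequences of a hypothesis a ≤ b (or a ≡ b) thereby become ring identities.
≤-transfer : ∀ {a b c d} → a ≤ b → b - a ≡ d - c → c ≤ d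
≤-transfer a≤b eq = ℤ.0≤i-j⇒j≤i (subst (0ℤ ≤_) eq (ℤ.i≤j⇒0≤j-i a≤b))

≡-transfer : ∀ {a b c d} → a ≡ b → b - a ≡ d - c → c ≡ d
≡-transfer {a} {b} {c} {d} a≡b eq = sym (ℤ.i-j≡0⇒i≡j _ _ (trans (sym eq) (ℤ.i≡j⇒i-j≡0 (sym a≡b))))

filter-does : ∀ {P Q : A → Set} (P? : Decidable P) (Q? : Decidable Q) →
              (∀ x → does (P? x) ≡ does (Q? x)) → ∀ xs → filter P? xs ≡ filter Q? xs
filter-does P? Q? eq [] = refl
filter-does P? Q? eq (x ∷ xs) with does (P? x) | does (Q? x) | eq x | filter-does P? Q? eq xs
... | true  | _ | refl | ih = cong (x ∷_) ih
... | false | _ | refl | ih = ih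

filter-map : ∀ {P : B → Set} (P? : Decidable P) (f : A → B) →
             ∀ xs → filter P? (map f xs) ≡ map f (filter (P? ∘ f) xs)
filter-map P? f [] = refl
filter-map P? f (x ∷ xs) with ih ← filter-map P? f xs | does (P? (f x))
... | true  = cong (f x ∷_) ih
... | false = ih

-- Neighbours in the Johnson graph as recursive lists

downs ups adj : ∀ {n} → Subset n → List (Subset n)

downs []            = []
downs (inside ∷ p)  = map (inside ∷_) (downs p) ++ (outside ∷ p) ∷ []
downs (outside ∷ p) = map (outside ∷_) (downs p)

ups []            = []
ups (inside ∷ p)  = map (inside ∷_) (ups p)
ups (outside ∷ p) = (inside ∷ p) ∷ map (outside ∷_) (ups p)

adj []            = []
adj (inside ∷ p)  = map (inside ∷_) (adj p) ++ map (outside ∷_) (ups p)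
adj (outside ∷ p) = map (inside ∷_) (downs p) ++ map (outside ∷_) (adj p)

-- `allSubsets` puts `inside` before `outside`, as do the clauses of `downs`, `ups` and `adj`. The
-- filtered lists therefore agree with the recursive ones as lists, and no permutations arise.
meeting : ∀ {n} → Subset n → ℕ → ℕ → List (Subset n)
meeting {n} p a b = filter (λ q → ∣ p ∩ q ∣ ℕ.≟ b) (kSubsets n a)

module _ {n : ℕ} where

  kSubsets-suc : ∀ a → kSubsets (suc n) (suc a) ≡
                 map (inside ∷_) (kSubsets n a) ++ map (outside ∷_) (kSubsets n (suc a))
  kSubsets-suc a = begin
    filter P (map (inside ∷_) (allSubsets n) ++ map (outside ∷_) (allSubsets n))
      ≡⟨ List.filter-++ P (map (inside ∷_) (allSubsets n)) _ ⟩
    filter P (map (inside ∷_) (allSubsets n)) ++ filter P (map (outside ∷_) (allSubsets n))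
      ≡⟨ cong₂ _++_ (filter-map P _ (allSubsets n)) (filter-map P _ (allSubsets n)) ⟩
    map (inside ∷_) (filter (P ∘ (inside ∷_)) (allSubsets n)) ++ map (outside ∷_) (kSubsets n (suc a))
      ≡⟨ cong (λ xs → map (inside ∷_) xs ++ map (outside ∷_) (kSubsets n (suc a)))
           (filter-does _ (λ q → ∣ q ∣ ℕ.≟ a) (λ _ → refl) (allSubsets n)) ⟩
    map (inside ∷_) (kSubsets n a) ++ map (outside ∷_) (kSubsets n (suc a)) ∎
    where
    open ≡-Reasoning
    P = λ (q : Subset (suc n)) → ∣ q ∣ ℕ.≟ suc a

  kSubsets-zero : kSubsets (suc n) 0 ≡ map (outside ∷_) (kSubsets n 0)
  kSubsets-zero = begin
    filter P (map (inside ∷_) (allSubsets n) ++ map (outside ∷_) (allSubsets n))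
      ≡⟨ List.filter-++ P (map (inside ∷_) (allSubsets n)) _ ⟩
    filter P (map (inside ∷_) (allSubsets n)) ++ filter P (map (outside ∷_) (allSubsets n))
      ≡⟨ cong₂ _++_ (List.filter-none P (All.map⁺ (All.universal (λ _ ()) (allSubsets n))))
                    (filter-map P _ (allSubsets n)) ⟩
    map (outside ∷_) (kSubsets n 0) ∎
    where
    open ≡-Reasoning
    P = λ (q : Subset (suc n)) → ∣ q ∣ ℕ.≟ 0

  private
    split : ∀ s (p : Subset n) b xs ys → 
            filter (λ q → ∣ (s ∷ p) ∩ q ∣ ℕ.≟ b) (map (inside ∷_) xs ++ map (outside ∷_) ys) ≡
            map (inside ∷_) (filter (λ q → ∣ (s ∷ p) ∩ (inside ∷ q) ∣ ℕ.≟ b) xs) ++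
            map (outside ∷_) (filter (λ q → ∣ (s ∷ p) ∩ (outside ∷ q) ∣ ℕ.≟ b) ys)
    split s p b xs ys = trans (List.filter-++ _ (map (inside ∷_) xs) _)
                              (cong₂ _++_ (filter-map _ _ xs) (filter-map _ _ ys))

  meeting-in : ∀ (p : Subset n) a b → meeting (inside ∷ p) (suc a) (suc b) ≡
               map (inside ∷_) (meeting p a b) ++ map (outside ∷_) (meeting p (suc a) (suc b))
  meeting-in p a b rewrite kSubsets-suc a = trans (split inside p (suc b) (kSubsets n a) _)
    (cong (λ xs → map (inside ∷_) xs ++ map (outside ∷_) (meeting p (suc a) (suc b)))
      (filter-does _ _ (λ _ → refl) (kSubsets n a)))

  meeting-in-zero : ∀ (p : Subset n) a → meeting (inside ∷ p) a 0 ≡ map (outside ∷_) (meeting p a 0)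
  meeting-in-zero p zero rewrite kSubsets-zero = filter-map _ _ (kSubsets n 0)
  meeting-in-zero p (suc a) rewrite kSubsets-suc a = trans (split inside p 0 (kSubsets n a) _)
    (cong (λ xs → map (inside ∷_) xs ++ map (outside ∷_) (meeting p (suc a) 0))
      (List.filter-none _ (All.universal (λ _ ()) (kSubsets n a))))

  meeting-out : ∀ (p : Subset n) a b → meeting (outside ∷ p) (suc a) b ≡
                map (inside ∷_) (meeting p a b) ++ map (outside ∷_) (meeting p (suc a) b)
  meeting-out p a b rewrite kSubsets-suc a = split outside p b (kSubsets n a) _

  meeting-out-zero : ∀ (p : Subset n) b → meeting (outside ∷ p) 0 b ≡ map (outside ∷_) (meeting p 0 b)
  meeting-out-zero p b rewrite kSubsets-zero = filter-map _ _ (kSubsets n 0)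

all-kSubsets : ∀ n k → All (λ p → ∣ p ∣ ≡ k) (kSubsets n k)
all-kSubsets n k = All.all-filter _ (allSubsets n)

meeting-empty : ∀ {n} (p : Subset n) a b → a ℕ.< b ⊎ ∣ p ∣ ℕ.< b → meeting p a b ≡ []
meeting-empty {n} p a b (inj₁ lt) = List.filter-none _ (All.map
  (λ {q} qa eq → ℕ.<⇒≢ (ℕ.≤-<-trans (p⊆q⇒∣p∣≤∣q∣ (p∩q⊆q p q)) (subst (ℕ._< b) (sym qa) lt)) eq)
  (all-kSubsets n a))
meeting-empty {n} p a b (inj₂ lt) = List.filter-none _ (All.universal
  (λ q eq → ℕ.<⇒≢ (ℕ.≤-<-trans (p⊆q⇒∣p∣≤∣q∣ (p∩q⊆p p q)) lt) eq) (kSubsets n a))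

meeting-self : ∀ {n} (p : Subset n) k → ∣ p ∣ ≡ k → meeting p k k ≡ p ∷ []
meeting-self []            zero    eq = refl
meeting-self (inside ∷ p)  (suc k) eq rewrite meeting-in p k k | meeting-self p k (ℕ.suc-injective eq)
  | meeting-empty p (suc k) (suc k) (inj₂ (ℕ.≤-reflexive eq)) = refl
meeting-self (outside ∷ p) zero    eq rewrite meeting-out-zero p 0 | meeting-self p 0 eq = refl
meeting-self (outside ∷ p) (suc k) eq rewrite meeting-out p k (suc k) | meeting-self p (suc k) eq
  | meeting-empty p k (suc k) (inj₁ ℕ.≤-refl) = refl

downs-⊥ : ∀ {n} (p : Subset n) → ∣ p ∣ ≡ 0 → downs p ≡ []
downs-⊥ []            eq = refl
downs-⊥ (outside ∷ p) eq rewrite downs-⊥ p eq = refl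

adj-⊥ : ∀ {n} (p : Subset n) → ∣ p ∣ ≡ 0 → adj p ≡ []
adj-⊥ []            eq = refl
adj-⊥ (outside ∷ p) eq rewrite downs-⊥ p eq | adj-⊥ p eq = refl

meeting-downs : ∀ {n} (p : Subset n) k → ∣ p ∣ ≡ suc k → meeting p k k ≡ downs p
meeting-downs (inside ∷ p) zero eq rewrite meeting-in-zero p 0
  | meeting-self p 0 (ℕ.suc-injective eq) | downs-⊥ p (ℕ.suc-injective eq) = refl
meeting-downs (inside ∷ p) (suc k) eq rewrite meeting-in p k k
  | meeting-downs p k (ℕ.suc-injective eq) | meeting-self p (suc k) (ℕ.suc-injective eq) = refl
meeting-downs (outside ∷ p) zero eq rewrite meeting-out-zero p 0 | meeting-downs p 0 eq = refl
meeting-downs (outside ∷ p) (suc k) eq rewrite meeting-out p k (suc k)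
  | meeting-empty p k (suc k) (inj₁ ℕ.≤-refl) | meeting-downs p (suc k) eq = refl

meeting-ups : ∀ {n} (p : Subset n) k → ∣ p ∣ ≡ k → meeting p (suc k) k ≡ ups p
meeting-ups [] zero eq = refl
meeting-ups (inside ∷ p) (suc k) eq rewrite meeting-in p (suc k) k
  | meeting-ups p k (ℕ.suc-injective eq)
  | meeting-empty p (suc (suc k)) (suc k) (inj₂ (ℕ.≤-reflexive eq)) = List.++-identityʳ _
meeting-ups (outside ∷ p) k eq rewrite meeting-out p k k
  | meeting-self p k eq | meeting-ups p k eq = refl

meeting-adj : ∀ {n} (p : Subset n) k → ∣ p ∣ ≡ suc k → meeting p (suc k) k ≡ adj p
meeting-adj (inside ∷ p) zero eq rewrite meeting-in-zero p 1
  | meeting-ups p 0 (ℕ.suc-injective eq) | adj-⊥ p (ℕ.suc-injective eq) = refl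
meeting-adj (inside ∷ p) (suc k) eq rewrite meeting-in p (suc k) k
  | meeting-adj p k (ℕ.suc-injective eq) | meeting-ups p (suc k) (ℕ.suc-injective eq) = refl
meeting-adj (outside ∷ p) k eq rewrite meeting-out p k k
  | meeting-downs p k eq | meeting-adj p k eq = refl

∈-kSubsets : ∀ {n} k (p : Subset n) → ∣ p ∣ ≡ k → p ∈ kSubsets n k
∈-kSubsets k p eq = proj₁ (∈-filter⁻ _ {xs = kSubsets _ k}
  (subst (p ∈_) (sym (meeting-self p k eq)) (here refl)))

adj-size : ∀ {n} (p : Subset n) k → ∣ p ∣ ≡ k → All (λ q → ∣ q ∣ ≡ k) (adj p)
adj-size p zero    eq rewrite adj-⊥ p eq = []
adj-size {n} p (suc k) eq = subst (All _) (meeting-adj p k eq)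
  (All.filter⁺ (λ q → ∣ p ∩ q ∣ ℕ.≟ k) (all-kSubsets n (suc k)))

-- Sizes and degrees

-- Carries the size of the complement as an index, so that inductions on p see both numbers without
-- subtraction.
data Sized : ∀ {n} → Subset n → ℕ → ℕ → Set where
  []   : Sized [] 0 0
  in∷  : ∀ {n k e} {p : Subset n} → Sized p k e → Sized (inside ∷ p) (suc k) e
  out∷ : ∀ {n k e} {p : Subset n} → Sized p k e → Sized (outside ∷ p) k (suc e)

sized : ∀ {n k} (p : Subset n) e → ∣ p ∣ ≡ k → k ℕ.+ e ≡ n → Sized p k e
sized []            e       refl refl = []
sized (inside ∷ p)  e       refl eq   = in∷ (sized p e refl (ℕ.suc-injective eq))
sized (outside ∷ p) zero    refl eq   =
  ⊥-elim (ℕ.<-irrefl (trans (sym (ℕ.+-identityʳ _)) eq) (ℕ.s≤s (∣p∣≤n p)))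
sized (outside ∷ p) (suc e) refl eq   =
  out∷ (sized p e refl (ℕ.suc-injective (trans (sym (ℕ.+-suc ∣ p ∣ e)) eq)))

length-map-++ : ∀ (f : A → B) (g : A → B) xs ys →
                length (map f xs ++ map g ys) ≡ length xs ℕ.+ length ys
length-map-++ f g xs ys = trans (List.length-++ (map f xs))
  (cong₂ ℕ._+_ (List.length-map f xs) (List.length-map g ys))

length-downs : ∀ {n k e} {p : Subset n} → Sized p k e → length (downs p) ≡ k
length-downs []               = refl
length-downs (in∷ {p = p} s)  = trans (length-map-++ (inside ∷_) (outside ∷_) (downs p) (p ∷ []))
  (trans (ℕ.+-comm _ 1) (cong suc (length-downs s)))
length-downs (out∷ {p = p} s) = trans (List.length-map _ (downs p)) (length-downs s)

length-ups : ∀ {n k e} {p : Subset n} → Sized p k e → length (ups p) ≡ e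
length-ups []               = refl
length-ups (in∷ {p = p} s)  = trans (List.length-map _ (ups p)) (length-ups s)
length-ups (out∷ {p = p} s) = cong suc (trans (List.length-map _ (ups p)) (length-ups s))

length-adj : ∀ {n k e} {p : Subset n} → Sized p k e → length (adj p) ≡ k ℕ.* e
length-adj [] = refl
length-adj (in∷ {k = k} {e} {p} s) = trans (length-map-++ _ _ (adj p) (ups p))
  (trans (cong₂ ℕ._+_ (length-adj s) (length-ups s)) (ℕ.+-comm (k ℕ.* e) e))
length-adj (out∷ {k = k} {e} {p} s) = trans (length-map-++ _ _ (downs p) (adj p))
  (trans (cong₂ ℕ._+_ (length-downs s) (length-adj s)) (sym (ℕ.*-suc k e)))

-- Sums over neighbours

∑ : List A → (A → ℤ) → ℤ
∑ xs f = sumℤ (map f xs)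

∑-++ : ∀ (xs ys : List A) f → ∑ (xs ++ ys) f ≡ ∑ xs f + ∑ ys f
∑-++ []       ys f = sym (ℤ.+-identityˡ _)
∑-++ (x ∷ xs) ys f = trans (cong (_+_ (f x)) (∑-++ xs ys f)) (sym (ℤ.+-assoc (f x) _ _))

∑-map : ∀ (g : B → A) xs f → ∑ (map g xs) f ≡ ∑ xs (f ∘ g)
∑-map g xs f = cong sumℤ (sym (List.map-∘ xs))

∑-cong : ∀ {f g : A → ℤ} {xs} → All (λ x → f x ≡ g x) xs → ∑ xs f ≡ ∑ xs g
∑-cong []         = refl
∑-cong (eq ∷ eqs) = cong₂ _+_ eq (∑-cong eqs)

∑-sub : ∀ (xs : List A) f g → ∑ xs (λ x → f x - g x) ≡ ∑ xs f - ∑ xs g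
∑-sub []       f g = refl
∑-sub (x ∷ xs) f g = trans (cong (_+_ (f x - g x)) (∑-sub xs f g)) (shuffle (f x) (g x) _ _)
  where
  shuffle : ∀ a b c d → a - b + (c - d) ≡ a + c - (b + d)
  shuffle = solve-∀

∑-≤ : ∀ {f : A → ℤ} {b} xs → All (λ x → f x ≤ b) xs → ∑ xs f ≤ + length xs * b
∑-≤ []                []         = ℤ.≤-refl
∑-≤ {b = b} (x ∷ xs) (le ∷ les) = ℤ.≤-trans (ℤ.+-mono-≤ le (∑-≤ xs les))
  (ℤ.≤-reflexive (sym (ℤ.suc-* (+ length xs) b)))

-- The tail is at most its length times b, so a head below b would leave the whole sum short.
∑-≡-max : ∀ {f : A → ℤ} {b} xs → All (λ x → f x ≤ b) xs → ∑ xs f ≡ + length xs * b →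
          All (λ x → f x ≡ b) xs
∑-≡-max [] [] eq = []
∑-≡-max {f = f} {b} (x ∷ xs) (le ∷ les) eq = fx≡b ∷ ∑-≡-max xs les (≡-transfer (trans (cong (_+ ∑ xs f) (sym fx≡b)) eq′)
    (shuffle b (∑ xs f) (+ length xs * b)))
  where
  shuffle : ∀ a b c → a + c - (a + b) ≡ c - b
  shuffle = solve-∀
  eq′ : f x + ∑ xs f ≡ b + + length xs * b
  eq′ = trans eq (ℤ.suc-* (+ length xs) b)
  fx≡b : f x ≡ b
  fx≡b = ℤ.≤-antisym le (≤-transfer (ℤ.≤-trans (ℤ.≤-reflexive (sym eq′)) (ℤ.+-monoʳ-≤ (f x) (∑-≤ xs les)))
    (shuffle′ b (f x) (+ length xs * b)))
    where
    shuffle′ : ∀ a b c → b + c - (a + c) ≡ b - a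
    shuffle′ = solve-∀

module _ {n} (p : Subset n) (f : Subset (suc n) → ℤ) where

  ∑-downs-in : ∑ (downs (inside ∷ p)) f ≡ f (outside ∷ p) + ∑ (downs p) (f ∘ (inside ∷_))
  ∑-downs-in = trans (∑-++ (map (inside ∷_) (downs p)) _ f)
    (trans (cong₂ _+_ (∑-map _ (downs p) f) (ℤ.+-identityʳ (f (outside ∷ p)))) (ℤ.+-comm _ (f (outside ∷ p))))

  ∑-downs-out : ∑ (downs (outside ∷ p)) f ≡ ∑ (downs p) (f ∘ (outside ∷_))
  ∑-downs-out = ∑-map _ (downs p) f

  ∑-ups-in : ∑ (ups (inside ∷ p)) f ≡ ∑ (ups p) (f ∘ (inside ∷_))
  ∑-ups-in = ∑-map _ (ups p) f

  ∑-ups-out : ∑ (ups (outside ∷ p)) f ≡ f (inside ∷ p) + ∑ (ups p) (f ∘ (outside ∷_))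
  ∑-ups-out = cong (_+_ (f (inside ∷ p))) (∑-map _ (ups p) f)

  ∑-adj-in : ∑ (adj (inside ∷ p)) f ≡ ∑ (adj p) (f ∘ (inside ∷_)) + ∑ (ups p) (f ∘ (outside ∷_))
  ∑-adj-in = trans (∑-++ (map (inside ∷_) (adj p)) _ f) (cong₂ _+_ (∑-map _ (adj p) f) (∑-map _ (ups p) f))

  ∑-adj-out : ∑ (adj (outside ∷ p)) f ≡ ∑ (downs p) (f ∘ (inside ∷_)) + ∑ (adj p) (f ∘ (outside ∷_))
  ∑-adj-out = trans (∑-++ (map (inside ∷_) (downs p)) _ f) (cong₂ _+_ (∑-map _ (downs p) f) (∑-map _ (adj p) f))

x+[y+z]≡y+[x+z] : ∀ x y z → x + (y + z) ≡ y + (x + z)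
x+[y+z]≡y+[x+z] = solve-∀

-- The exchanged points are the head and position j. Neighbours are sorted by how they meet position
-- j; inserting at an inner position reorders the neighbour list in general, so these identities are
-- about sums and not lists.
∑-downs-insert-in : ∀ {n} (j : Fin (suc n)) (p : Subset n) f → ∑ (downs (insertAt p j inside)) f ≡
                    f (insertAt p j outside) + ∑ (downs p) (λ q → f (insertAt q j inside))
∑-downs-insert-in zero p f = ∑-downs-in p f
∑-downs-insert-in (suc j) (inside ∷ p) f
  rewrite ∑-downs-in (insertAt p j inside) f | ∑-downs-insert-in j p (f ∘ (inside ∷_))
        | ∑-downs-in p (λ q → f (insertAt q (suc j) inside))
  = x+[y+z]≡y+[x+z] (f (outside ∷ insertAt p j inside)) (f (inside ∷ insertAt p j outside)) _
∑-downs-insert-in (suc j) (outside ∷ p) f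
  rewrite ∑-downs-out (insertAt p j inside) f | ∑-downs-insert-in j p (f ∘ (outside ∷_))
        | ∑-downs-out p (λ q → f (insertAt q (suc j) inside))
  = refl

∑-downs-insert-out : ∀ {n} (j : Fin (suc n)) (p : Subset n) f → ∑ (downs (insertAt p j outside)) f ≡
                     ∑ (downs p) (λ q → f (insertAt q j outside))
∑-downs-insert-out zero p f = ∑-downs-out p f
∑-downs-insert-out (suc j) (inside ∷ p) f
  rewrite ∑-downs-in (insertAt p j outside) f | ∑-downs-insert-out j p (f ∘ (inside ∷_))
        | ∑-downs-in p (λ q → f (insertAt q (suc j) outside))
  = refl
∑-downs-insert-out (suc j) (outside ∷ p) f
  rewrite ∑-downs-out (insertAt p j outside) f | ∑-downs-insert-out j p (f ∘ (outside ∷_))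
        | ∑-downs-out p (λ q → f (insertAt q (suc j) outside))
  = refl

∑-ups-insert-in : ∀ {n} (j : Fin (suc n)) (p : Subset n) f → ∑ (ups (insertAt p j inside)) f ≡
                  ∑ (ups p) (λ q → f (insertAt q j inside))
∑-ups-insert-in zero p f = ∑-ups-in p f
∑-ups-insert-in (suc j) (inside ∷ p) f
  rewrite ∑-ups-in (insertAt p j inside) f | ∑-ups-insert-in j p (f ∘ (inside ∷_))
        | ∑-ups-in p (λ q → f (insertAt q (suc j) inside))
  = refl
∑-ups-insert-in (suc j) (outside ∷ p) f
  rewrite ∑-ups-out (insertAt p j inside) f | ∑-ups-insert-in j p (f ∘ (outside ∷_))
        | ∑-ups-out p (λ q → f (insertAt q (suc j) inside))
  = refl

∑-ups-insert-out : ∀ {n} (j : Fin (suc n)) (p : Subset n) f → ∑ (ups (insertAt p j outside)) f ≡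
                   f (insertAt p j inside) + ∑ (ups p) (λ q → f (insertAt q j outside))
∑-ups-insert-out zero p f = ∑-ups-out p f
∑-ups-insert-out (suc j) (inside ∷ p) f
  rewrite ∑-ups-in (insertAt p j outside) f | ∑-ups-insert-out j p (f ∘ (inside ∷_))
        | ∑-ups-in p (λ q → f (insertAt q (suc j) outside))
  = refl
∑-ups-insert-out (suc j) (outside ∷ p) f
  rewrite ∑-ups-out (insertAt p j outside) f | ∑-ups-insert-out j p (f ∘ (outside ∷_))
        | ∑-ups-out p (λ q → f (insertAt q (suc j) outside))
  = x+[y+z]≡y+[x+z] (f (inside ∷ insertAt p j outside)) (f (outside ∷ insertAt p j inside)) _

∑-adj-insert-in : ∀ {n} (j : Fin (suc n)) (p : Subset n) f → ∑ (adj (insertAt p j inside)) f ≡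
                  ∑ (adj p) (λ q → f (insertAt q j inside)) + ∑ (ups p) (λ q → f (insertAt q j outside))
∑-adj-insert-in zero p f = ∑-adj-in p f
∑-adj-insert-in (suc j) (inside ∷ p) f
  rewrite ∑-adj-in (insertAt p j inside) f | ∑-adj-insert-in j p (f ∘ (inside ∷_))
        | ∑-ups-insert-in j p (f ∘ (outside ∷_))
        | ∑-adj-in p (λ q → f (insertAt q (suc j) inside))
        | ∑-ups-in p (λ q → f (insertAt q (suc j) outside))
  = shuffle (∑ (adj p) _) _ _
  where
  shuffle : ∀ x y z → x + y + z ≡ x + z + y
  shuffle = solve-∀
∑-adj-insert-in (suc j) (outside ∷ p) f
  rewrite ∑-adj-out (insertAt p j inside) f | ∑-downs-insert-in j p (f ∘ (inside ∷_))
        | ∑-adj-insert-in j p (f ∘ (outside ∷_))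
        | ∑-adj-out p (λ q → f (insertAt q (suc j) inside))
        | ∑-ups-out p (λ q → f (insertAt q (suc j) outside))
  = shuffle (f (inside ∷ insertAt p j outside)) _ _ _
  where
  shuffle : ∀ x y z w → x + y + (z + w) ≡ y + z + (x + w)
  shuffle = solve-∀

∑-adj-insert-out : ∀ {n} (j : Fin (suc n)) (p : Subset n) f → ∑ (adj (insertAt p j outside)) f ≡
                   ∑ (downs p) (λ q → f (insertAt q j inside)) + ∑ (adj p) (λ q → f (insertAt q j outside))
∑-adj-insert-out zero p f = ∑-adj-out p f
∑-adj-insert-out (suc j) (inside ∷ p) f
  rewrite ∑-adj-in (insertAt p j outside) f | ∑-adj-insert-out j p (f ∘ (inside ∷_))
        | ∑-ups-insert-out j p (f ∘ (outside ∷_))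
        | ∑-downs-in p (λ q → f (insertAt q (suc j) inside))
        | ∑-adj-in p (λ q → f (insertAt q (suc j) outside))
  = shuffle (∑ (downs p) _) _ (f (outside ∷ insertAt p j inside)) _
  where
  shuffle : ∀ x y z w → x + y + (z + w) ≡ z + x + (y + w)
  shuffle = solve-∀
∑-adj-insert-out (suc j) (outside ∷ p) f
  rewrite ∑-adj-out (insertAt p j outside) f | ∑-downs-insert-out j p (f ∘ (inside ∷_))
        | ∑-adj-insert-out j p (f ∘ (outside ∷_))
        | ∑-downs-out p (λ q → f (insertAt q (suc j) inside))
        | ∑-adj-out p (λ q → f (insertAt q (suc j) outside))
  = x+[y+z]≡y+[x+z] (∑ (downs p) _) (∑ (downs p) _) _

-- Connectivity and the maximum principle

downs⇒ups : ∀ {n} {p q : Subset n} → q ∈ downs p → p ∈ ups q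
downs⇒ups {p = inside ∷ p} q∈ with ∈-++⁻ (map (inside ∷_) (downs p)) q∈
... | inj₁ q∈′ with _ , r∈ , refl ← ∈-map⁻ (inside ∷_) q∈′ = ∈-map⁺ (inside ∷_) (downs⇒ups r∈)
... | inj₂ (here refl) = here refl
downs⇒ups {p = outside ∷ p} q∈ with _ , r∈ , refl ← ∈-map⁻ (outside ∷_) q∈ =
  there (∈-map⁺ (outside ∷_) (downs⇒ups r∈))

adj⇒common-up : ∀ {n} (p : Subset n) {q} → q ∈ adj p → ∃ λ t → t ∈ ups p × t ∈ ups q
adj⇒common-up (inside ∷ p) q∈ with ∈-++⁻ (map (inside ∷_) (adj p)) q∈
... | inj₁ q∈′ with _ , r∈ , refl ← ∈-map⁻ (inside ∷_) q∈′ with t , t∈p , t∈r ← adj⇒common-up p r∈ =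
  inside ∷ t , ∈-map⁺ (inside ∷_) t∈p , ∈-map⁺ (inside ∷_) t∈r
... | inj₂ q∈′ with r , r∈ , refl ← ∈-map⁻ (outside ∷_) q∈′ =
  inside ∷ r , ∈-map⁺ (inside ∷_) r∈ , here refl
adj⇒common-up (outside ∷ p) q∈ with ∈-++⁻ (map (inside ∷_) (downs p)) q∈
... | inj₁ q∈′ with _ , r∈ , refl ← ∈-map⁻ (inside ∷_) q∈′ =
  inside ∷ p , here refl , ∈-map⁺ (inside ∷_) (downs⇒ups r∈)
... | inj₂ q∈′ with _ , r∈ , refl ← ∈-map⁻ (outside ∷_) q∈′ with t , t∈p , t∈r ← adj⇒common-up p r∈ =
  outside ∷ t , there (∈-map⁺ (outside ∷_) t∈p) , there (∈-map⁺ (outside ∷_) t∈r)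

downs-nonempty : ∀ {n} (p : Subset n) {k} → ∣ p ∣ ≡ suc k → ∃ λ q → ∣ q ∣ ≡ k × q ∈ downs p
downs-nonempty (inside ∷ p)  eq = outside ∷ p , ℕ.suc-injective eq , ∈-++⁺ʳ (map (inside ∷_) (downs p)) (here refl)
downs-nonempty (outside ∷ p) eq with q , eq′ , q∈ ← downs-nonempty p eq =
  outside ∷ q , eq′ , ∈-map⁺ (outside ∷_) q∈

ups⇒insert : ∀ {n} {p t : Subset (suc n)} → t ∈ ups p →
             ∃₂ λ j r → p ≡ insertAt r j outside × t ≡ insertAt r j inside
ups⇒insert {p = outside ∷ p} (here refl) = zero , p , refl , refl
ups⇒insert {zero} {inside ∷ []} ()
ups⇒insert {zero} {outside ∷ []} (there ())
ups⇒insert {suc n} {inside ∷ p} t∈ with _ , r∈ , refl ← ∈-map⁻ (inside ∷_) t∈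
  with j , r , refl , refl ← ups⇒insert {p = p} r∈ = suc j , inside ∷ r , refl , refl
ups⇒insert {suc n} {outside ∷ p} (there t∈) with _ , r∈ , refl ← ∈-map⁻ (outside ∷_) t∈
  with j , r , refl , refl ← ups⇒insert {p = p} r∈ = suc j , outside ∷ r , refl , refl

∣insert-in∣ : ∀ {n} (p : Subset n) j → ∣ insertAt p j inside ∣ ≡ suc ∣ p ∣
∣insert-in∣ p             zero    = refl
∣insert-in∣ (inside ∷ p)  (suc j) = cong suc (∣insert-in∣ p j)
∣insert-in∣ (outside ∷ p) (suc j) = ∣insert-in∣ p j

∣insert-out∣ : ∀ {n} (p : Subset n) j → ∣ insertAt p j outside ∣ ≡ ∣ p ∣
∣insert-out∣ p             zero    = refl
∣insert-out∣ (inside ∷ p)  (suc j) = cong suc (∣insert-out∣ p j)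
∣insert-out∣ (outside ∷ p) (suc j) = ∣insert-out∣ p j

Closed : ∀ {n} → ℕ → (Subset n → Set) → Set
Closed k P = ∀ p → ∣ p ∣ ≡ k → P p → All P (adj p)

closed-in : ∀ {n k} {P : Subset (suc n) → Set} → Closed (suc k) P → Closed k (P ∘ (inside ∷_))
closed-in closed p eq Pp = All.map⁻ (All.++⁻ˡ (map (inside ∷_) (adj p)) (closed (inside ∷ p) (cong suc eq) Pp))

closed-out : ∀ {n k} {P : Subset (suc n) → Set} → Closed k P → Closed k (P ∘ (outside ∷_))
closed-out closed p eq Pp = All.map⁻ (All.++⁻ʳ (map (inside ∷_) (downs p)) (closed (outside ∷ p) eq Pp))

-- Connectivity as an induction principle, which avoids building paths. Equal heads are dropped; if
-- the heads differ, one exchange with the first coordinate moves between the two sides.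
adj-connected : ∀ {n} (P : Subset n → Set) {k} → Closed k P →
                ∀ p q → ∣ p ∣ ≡ k → ∣ q ∣ ≡ k → P p → P q
adj-connected P closed [] [] _ _ Pp = Pp
adj-connected P {suc k} closed (inside ∷ p) (inside ∷ q) eqp eqq Pp =
  adj-connected (P ∘ (inside ∷_)) (closed-in {P = P} closed) p q (ℕ.suc-injective eqp) (ℕ.suc-injective eqq) Pp
adj-connected P closed (outside ∷ p) (outside ∷ q) eqp eqq Pp =
  adj-connected (P ∘ (outside ∷_)) (closed-out {P = P} closed) p q eqp eqq Pp
adj-connected P {suc k} closed (inside ∷ p) (outside ∷ q) eqp eqq Pp
  with q′ , eqq′ , q′∈ ← downs-nonempty q eqq =
  All.lookup (closed (inside ∷ q′) (cong suc eqq′)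
      (adj-connected (P ∘ (inside ∷_)) (closed-in {P = P} closed) p q′ (ℕ.suc-injective eqp) eqq′ Pp))
    (∈-++⁺ʳ (map (inside ∷_) (adj q′)) (∈-map⁺ (outside ∷_) (downs⇒ups q′∈)))
adj-connected P {suc k} closed (outside ∷ p) (inside ∷ q) eqp eqq Pp
  with p′ , eqp′ , p′∈ ← downs-nonempty p eqp =
  adj-connected (P ∘ (inside ∷_)) (closed-in {P = P} closed) p′ q eqp′ (ℕ.suc-injective eqq)
    (All.lookup (closed (outside ∷ p) eqp Pp) (∈-++⁺ˡ (∈-map⁺ (inside ∷_) p′∈)))

subset-of-size : ∀ {n k} → k ℕ.≤ n → ∃ λ (p : Subset n) → ∣ p ∣ ≡ k
subset-of-size {zero}  ℕ.z≤n = [] , refl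
subset-of-size {suc n} ℕ.z≤n with p , eq ← subset-of-size {n} ℕ.z≤n = outside ∷ p , eq
subset-of-size (ℕ.s≤s k≤n) with p , eq ← subset-of-size k≤n = inside ∷ p , cong suc eq

-- A function whose neighbour sums are degree times its value attains its
-- maximum at every neighbour of a maximum point.
harmonic-constant : ∀ {n} k e → k ℕ.+ e ≡ n → (g : Subset n → ℤ) →
  (∀ p → ∣ p ∣ ≡ k → ∑ (adj p) g ≡ + (k ℕ.* e) * g p) → ∃ λ b → ∀ p → ∣ p ∣ ≡ k → g p ≡ b
harmonic-constant {n} k e refl g harmonic = g top , λ p eq →
  adj-connected (λ q → g q ≡ g top) closed top p ∣top∣ eq refl
  where
  start = subset-of-size (ℕ.m≤m+n k e)
  top   = argmax g (proj₁ start) (kSubsets n k)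
  ∣top∣ : ∣ top ∣ ≡ k
  ∣top∣ = argmax-all g (proj₂ start) (all-kSubsets n k)
  ≤top : ∀ q → ∣ q ∣ ≡ k → g q ≤ g top
  ≤top q eq = All.lookup (f[xs]≤f[argmax] (proj₁ start) (kSubsets n k)) (∈-kSubsets k q eq)
  degree : ∀ q → ∣ q ∣ ≡ k → k ℕ.* e ≡ length (adj q)
  degree q eq = sym (length-adj (sized q e eq refl))
  closed : Closed k (λ q → g q ≡ g top)
  closed q eq max = ∑-≡-max (adj q) (All.map (λ {r} → ≤top r) (adj-size q k eq))
    (trans (harmonic q eq) (cong₂ (λ l b → + l * b) (degree q eq) max))

-- The affine form of an eigenvector

σ : ∀ {n} → Vec ℤ n → Subset n → ℤ
σ []      []            = 0ℤ
σ (x ∷ d) (inside ∷ p)  = x + σ d p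
σ (x ∷ d) (outside ∷ p) = σ d p

σ-insert : ∀ {n} (d : Vec ℤ (suc n)) p j →
           σ d (insertAt p j inside) ≡ lookup d j + σ d (insertAt p j outside)
σ-insert (x ∷ d) p             zero    = refl
σ-insert (x ∷ d) (inside ∷ p)  (suc j) rewrite σ-insert d p j = x+[y+z]≡y+[x+z] x (lookup d j) _
σ-insert (x ∷ d) (outside ∷ p) (suc j) = σ-insert d p j

module _ {n k′} (k′≤n : k′ ℕ.≤ n) (v : Subset (suc (suc n)) → ℤ) (b : Fin (suc n) → ℤ)
         (gap : ∀ j r → ∣ r ∣ ≡ k′ →
                v (inside ∷ insertAt r j outside) - v (outside ∷ insertAt r j inside) ≡ b j) where

  private
    -- On sets of fixed size the slopes matter only up to a common shift, so the first slope may be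
    -- 0. The gap c 0 - c j = b j then forces the others.
    weights : Vec ℤ (suc n)
    weights = tabulate (λ j → - b j)

    residue : Subset (suc (suc n)) → ℤ
    residue p = v p - σ (0ℤ ∷ weights) p

    residue-up : ∀ {p t} → ∣ p ∣ ≡ k′ → t ∈ ups p → residue (inside ∷ p) ≡ residue (outside ∷ t)
    residue-up {p} eq t∈ with j , r , refl , refl ← ups⇒insert {p = p} t∈
      rewrite σ-insert weights r j | lookup∘tabulate (λ j → - b j) j =
      ≡-transfer (gap j r (trans (sym (∣insert-out∣ r j)) eq))
        (shuffle (v (inside ∷ insertAt r j outside)) (v (outside ∷ insertAt r j inside))
          (b j) (σ weights (insertAt r j outside)))
      where
      shuffle : ∀ a b c s → c - (a - b) ≡ b - (- c + s) - (a - (0ℤ + s))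
      shuffle = solve-∀

    base = subset-of-size {suc n} (ℕ.m≤n⇒m≤1+n k′≤n)

    K : ℤ
    K = residue (inside ∷ proj₁ base)

    -- The gaps concern only exchanges with the first coordinate. An exchange of p for an adjacent q
    -- behind that coordinate is two of them: the first point is traded for the one that completes p
    -- to p ∪ q, and traded back to leave q.
    residue-in : ∀ p → ∣ p ∣ ≡ k′ → residue (inside ∷ p) ≡ K
    residue-in p eq = adj-connected P closed _ p (proj₂ base) eq refl
      where
      P = λ q → residue (inside ∷ q) ≡ K
      closed : Closed k′ P
      closed q eq′ eqK = All.tabulate λ {r} r∈ → let t , t∈q , t∈r = adj⇒common-up q r∈ in
        trans (residue-up {r} (All.lookup (adj-size q k′ eq′) r∈) t∈r) (trans (sym (residue-up {q} eq′ t∈q)) eqK)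

    residue-const : ∀ p → ∣ p ∣ ≡ suc k′ → residue p ≡ K
    residue-const (inside ∷ p)  eq = residue-in p (ℕ.suc-injective eq)
    residue-const (outside ∷ p) eq with q , eq′ , q∈ ← downs-nonempty p eq =
      trans (sym (residue-up {q} eq′ (downs⇒ups q∈))) (residue-in q eq′)

  affine-of-gaps : ∃₂ λ K d → ∀ p → ∣ p ∣ ≡ suc k′ → v p ≡ K + σ d p
  affine-of-gaps = K , 0ℤ ∷ weights , λ p eq →
    ≡-transfer (residue-const p eq) (shuffle (v p) (σ (0ℤ ∷ weights) p) K)
    where
    shuffle : ∀ a s k → k - (a - s) ≡ k + s - a
    shuffle = solve-∀

module _ {n k′ e′} (size : k′ ℕ.+ e′ ≡ n) (v : Subset (suc (suc n)) → ℤ)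
         (eigen : ∀ p → ∣ p ∣ ≡ suc k′ → ∑ (adj p) v ≡ (+ (k′ ℕ.* e′) - 1ℤ) * v p) where

  private
    vᵢₒ vₒᵢ : Fin (suc n) → Subset n → ℤ
    vᵢₒ j q = v (inside ∷ insertAt q j outside)
    vₒᵢ j q = v (outside ∷ insertAt q j inside)

    -- Subtracting the eigenvalue equations at two vertices exchanged by a
    -- transposition leaves an equation on J(n, k′), whose degree is θ₁ + 1.
    gap-harmonic : ∀ j r → ∣ r ∣ ≡ k′ → ∑ (adj r) (λ q → vᵢₒ j q - vₒᵢ j q) ≡
                   + (k′ ℕ.* e′) * (vᵢₒ j r - vₒᵢ j r)
    gap-harmonic j r eq = trans (∑-sub (adj r) (vᵢₒ j) (vₒᵢ j))
      (≡-transfer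
        (cong₂ _-_ (trans (sym eq₁) (eigen _ (cong suc (trans (∣insert-out∣ r j) eq))))
                   (trans (sym eq₂) (eigen _ (trans (∣insert-in∣ r j) (cong suc eq)))))
        (shuffle (vᵢₒ j r) (vₒᵢ j r) (∑ (adj r) (vᵢₒ j)) (∑ (adj r) (vₒᵢ j)) x y (+ (k′ ℕ.* e′))))
      where
      x y : ℤ
      -- Neighbours that contain both exchanged points (`x`), or neither (`y`), are common to the
      -- two vertices and cancel.
      x = ∑ (downs r) (λ q → v (inside ∷ insertAt q j inside))
      y = ∑ (ups r) (λ q → v (outside ∷ insertAt q j outside))
      eq₁ : ∑ (adj (inside ∷ insertAt r j outside)) v ≡ (x + ∑ (adj r) (vᵢₒ j)) + (vₒᵢ j r + y)
      eq₁ = trans (∑-adj-in (insertAt r j outside) v)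
        (cong₂ _+_ (∑-adj-insert-out j r (v ∘ (inside ∷_))) (∑-ups-insert-out j r (v ∘ (outside ∷_))))
      eq₂ : ∑ (adj (outside ∷ insertAt r j inside)) v ≡ (vᵢₒ j r + x) + (∑ (adj r) (vₒᵢ j) + y)
      eq₂ = trans (∑-adj-out (insertAt r j inside) v)
        (cong₂ _+_ (∑-downs-insert-in j r (v ∘ (inside ∷_))) (∑-adj-insert-in j r (v ∘ (outside ∷_))))
      shuffle : ∀ a b s t x y c → (c - 1ℤ) * a - (c - 1ℤ) * b - ((x + s + (b + y)) - ((a + x) + (t + y))) ≡
                c * (a - b) - (s - t)
      shuffle = solve-∀

    gap-constant : ∀ j → ∃ λ b → ∀ r → ∣ r ∣ ≡ k′ → vᵢₒ j r - vₒᵢ j r ≡ b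
    gap-constant j = harmonic-constant k′ e′ size (λ q → vᵢₒ j q - vₒᵢ j q) (gap-harmonic j)

  eigenvector-affine : ∃₂ λ K d → ∀ p → ∣ p ∣ ≡ suc k′ → v p ≡ K + σ d p
  eigenvector-affine = affine-of-gaps (ℕ.m+n≤o⇒m≤o k′ (ℕ.≤-reflexive size)) v
    (λ j → proj₁ (gap-constant j)) (λ j → proj₂ (gap-constant j))

-- Neighbour sums of affine functions and the balance equation

private
  assoc-in : ∀ {n} {f : Subset (suc n) → ℤ} K x d → (∀ q → f q ≡ K + σ (x ∷ d) q) →
             ∀ q → f (inside ∷ q) ≡ (K + x) + σ d q
  assoc-in K x d h q = trans (h (inside ∷ q)) (sym (ℤ.+-assoc K x (σ d q)))

-- Each point of p is dropped once, which costs σ d p in total. The function is abstracted to `f`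
-- because restricting it to `inside ∷ q` moves the head slope into the constant, so the induction
-- has to vary K.
∑-downs-affine : ∀ {n k e} {p : Subset n} → Sized p k e → ∀ {f} K d → (∀ q → f q ≡ K + σ d q) →
                 ∑ (downs p) f ≡ + k * (K + σ d p) - σ d p
∑-downs-affine [] K [] h = refl
∑-downs-affine {k = suc k} {p = inside ∷ p} (in∷ s) {f} K (x ∷ d) h = begin
  ∑ (downs (inside ∷ p)) f                    ≡⟨ ∑-downs-in p f ⟩
  f (outside ∷ p) + ∑ (downs p) _             ≡⟨ cong₂ _+_ (h (outside ∷ p)) (∑-downs-affine s (K + x) d (assoc-in {f = f} K x d h)) ⟩
  _                                           ≡⟨ shuffle K x (σ d p) (+ k) ⟩
  + suc k * (K + (x + σ d p)) - (x + σ d p)   ∎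
  where
  open ≡-Reasoning
  shuffle : ∀ K x s k → K + s + (k * (K + x + s) - s) ≡ (1ℤ + k) * (K + (x + s)) - (x + s)
  shuffle = solve-∀
∑-downs-affine {p = outside ∷ p} (out∷ s) {f} K (x ∷ d) h =
  trans (∑-downs-out p f) (∑-downs-affine s K d (h ∘ (outside ∷_)))

∑-ups-affine : ∀ {n k e} {p : Subset n} → Sized p k e → ∀ {f} K d → (∀ q → f q ≡ K + σ d q) →
               ∑ (ups p) f ≡ + e * (K + σ d p) + (σ d full - σ d p)
∑-ups-affine [] K [] h = refl
∑-ups-affine {e = e} {p = inside ∷ p} (in∷ s) {f} K (x ∷ d) h = begin
  ∑ (ups (inside ∷ p)) f  ≡⟨ ∑-ups-in p f ⟩
  ∑ (ups p) _             ≡⟨ ∑-ups-affine s (K + x) d (assoc-in {f = f} K x d h) ⟩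
  _                       ≡⟨ shuffle K x (σ d p) (+ e) (σ d full) ⟩
  + e * (K + (x + σ d p)) + ((x + σ d full) - (x + σ d p)) ∎
  where
  open ≡-Reasoning
  shuffle : ∀ K x s e t → e * (K + x + s) + (t - s) ≡ e * (K + (x + s)) + ((x + t) - (x + s))
  shuffle = solve-∀
∑-ups-affine {e = suc e} {p = outside ∷ p} (out∷ s) {f} K (x ∷ d) h = begin
  ∑ (ups (outside ∷ p)) f           ≡⟨ ∑-ups-out p f ⟩
  f (inside ∷ p) + ∑ (ups p) _      ≡⟨ cong₂ _+_ (h (inside ∷ p)) (∑-ups-affine s K d (h ∘ (outside ∷_))) ⟩
  _                                 ≡⟨ shuffle K x (σ d p) (+ e) (σ d full) ⟩
  + suc e * (K + σ d p) + ((x + σ d full) - σ d p) ∎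
  where
  open ≡-Reasoning
  shuffle : ∀ K x s e t → K + (x + s) + (e * (K + s) + (t - s)) ≡ (1ℤ + e) * (K + s) + ((x + t) - s)
  shuffle = solve-∀

-- Among the k e exchanges every point of p is dropped e times and every point outside p is added k
-- times.
∑-adj-affine : ∀ {n k e} {p : Subset n} → Sized p k e → ∀ {f} K d → (∀ q → f q ≡ K + σ d q) →
               ∑ (adj p) f ≡ + k * + e * (K + σ d p) - (+ k + + e) * σ d p + + k * σ d full
∑-adj-affine [] K [] h = refl
∑-adj-affine {k = suc k} {e} {inside ∷ p} (in∷ s) {f} K (x ∷ d) h = begin
  ∑ (adj (inside ∷ p)) f      ≡⟨ ∑-adj-in p f ⟩
  ∑ (adj p) _ + ∑ (ups p) _   ≡⟨ cong₂ _+_ (∑-adj-affine s (K + x) d (assoc-in {f = f} K x d h)) (∑-ups-affine s K d (h ∘ (outside ∷_))) ⟩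
  _                           ≡⟨ shuffle K x (σ d p) (+ k) (+ e) (σ d full) ⟩
  + suc k * + e * (K + (x + σ d p)) - (+ suc k + + e) * (x + σ d p) + + suc k * (x + σ d full) ∎
  where
  open ≡-Reasoning
  shuffle : ∀ K x s k e t → (k * e * (K + x + s) - (k + e) * s + k * t) + (e * (K + s) + (t - s)) ≡
            (1ℤ + k) * e * (K + (x + s)) - (1ℤ + k + e) * (x + s) + (1ℤ + k) * (x + t)
  shuffle = solve-∀
∑-adj-affine {k = k} {suc e} {outside ∷ p} (out∷ s) {f} K (x ∷ d) h = begin
  ∑ (adj (outside ∷ p)) f       ≡⟨ ∑-adj-out p f ⟩
  ∑ (downs p) _ + ∑ (adj p) _   ≡⟨ cong₂ _+_ (∑-downs-affine s (K + x) d (assoc-in {f = f} K x d h)) (∑-adj-affine s K d (h ∘ (outside ∷_))) ⟩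
  _                             ≡⟨ shuffle K x (σ d p) (+ k) (+ e) (σ d full) ⟩
  + k * + suc e * (K + σ d p) - (+ k + + suc e) * σ d p + + k * (x + σ d full) ∎
  where
  open ≡-Reasoning
  shuffle : ∀ K x s k e t → (k * (K + x + s) - s) + (k * e * (K + s) - (k + e) * s + k * t) ≡
            k * (1ℤ + e) * (K + s) - (k + (1ℤ + e)) * s + k * (x + t)
  shuffle = solve-∀

record Affine (n k : ℕ) (v : Subset n → ℤ) : Set where
  constructor affine
  field
    const    : ℤ
    slope    : Vec ℤ n
    values   : ∀ p → ∣ p ∣ ≡ k → v p ≡ const + σ slope p
    balanced : + n * const + + k * σ slope full ≡ 0ℤ

private
  coefficient : ∀ k′ e′ → + (k′ ℕ.* e′) - 1ℤ ≡ + suc k′ * + suc e′ - (+ suc k′ + + suc e′)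
  coefficient k′ e′ = trans (cong (_- 1ℤ) (ℤ.pos-* k′ e′)) (shuffle (+ k′) (+ e′))
    where
    shuffle : ∀ k e → k * e - 1ℤ ≡ (1ℤ + k) * (1ℤ + e) - (1ℤ + k + (1ℤ + e))
    shuffle = solve-∀

  balance : ∀ K s k e t → k * e * (K + s) - (k + e) * s + k * t ≡ (k * e - (k + e)) * (K + s) →
            (k + e) * K + k * t ≡ 0ℤ
  balance K s k e t eq = ≡-transfer eq (shuffle K s k e t)
    where
    shuffle : ∀ K s k e t → (k * e - (k + e)) * (K + s) - (k * e * (K + s) - (k + e) * s + k * t) ≡
              0ℤ - ((k + e) * K + k * t)
    shuffle = solve-∀

-- With e = n - k the eigenvalue θ₁ is k e - (k + e). The terms in σ d p then cancel, so the
-- equation at a single vertex already gives the balance.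
eigen⇒balanced : ∀ {n k e} {p : Subset n} → Sized p k e → ∀ K d →
  ∑ (adj p) (λ q → K + σ d q) ≡ (+ k * + e - (+ k + + e)) * (K + σ d p) →
  + (k ℕ.+ e) * K + + k * σ d full ≡ 0ℤ
eigen⇒balanced {k = k} {e} {p} s K d eigen = balance K (σ d p) (+ k) (+ e) (σ d full)
  (trans (sym (∑-adj-affine s K d (λ _ → refl))) eigen)

affine-eigenvector : ∀ {n k′ e′} → k′ ℕ.+ e′ ≡ n → (v : Subset (suc (suc n)) → ℤ) →
  (∀ p → ∣ p ∣ ≡ suc k′ → ∑ (adj p) v ≡ (+ (k′ ℕ.* e′) - 1ℤ) * v p) → Affine (suc (suc n)) (suc k′) v
affine-eigenvector {n} {k′} {e′} refl v eigen = build (eigenvector-affine refl v eigen)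
  (subset-of-size (ℕ.s≤s (ℕ.m≤n⇒m≤1+n (ℕ.m≤m+n k′ e′))))
  where
  n≡ : suc k′ ℕ.+ suc e′ ≡ suc (suc n)
  n≡ = cong suc (ℕ.+-suc k′ e′)
  build : (∃₂ λ K d → ∀ p → ∣ p ∣ ≡ suc k′ → v p ≡ K + σ d p) →
          (∃ λ (p : Subset (suc (suc n))) → ∣ p ∣ ≡ suc k′) → Affine (suc (suc n)) (suc k′) v
  build (K , d , v≡) (p , ∣p∣) = affine K d v≡ (subst (λ m → + m * K + + suc k′ * σ d full ≡ 0ℤ) n≡
    (eigen⇒balanced split K d eigen-affine))
    where
    split : Sized p (suc k′) (suc e′)
    split = sized p (suc e′) ∣p∣ n≡
    eigen-affine : ∑ (adj p) (λ q → K + σ d q) ≡ (+ suc k′ * + suc e′ - (+ suc k′ + + suc e′)) * (K + σ d p)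
    eigen-affine = trans (sym (∑-cong (All.map (λ {q} → v≡ q) (adj-size p (suc k′) ∣p∣))))
      (trans (eigen p ∣p∣) (cong₂ _*_ (coefficient k′ e′) (v≡ p ∣p∣)))

θ₁-≡ : ∀ k′ e′ → θ₁ (suc (suc (k′ ℕ.+ e′))) (suc k′) ≡ + (k′ ℕ.* e′) - 1ℤ
θ₁-≡ k′ e′ = trans (shuffle (+ k′) (+ e′)) (cong (_- 1ℤ) (sym (ℤ.pos-* k′ e′)))
  where
  shuffle : ∀ k e → (1ℤ + k - 1ℤ) * (1ℤ + (1ℤ + (k + e)) - (1ℤ + k) - 1ℤ) - 1ℤ ≡ k * e - 1ℤ
  shuffle = solve-∀

-- Normal form of an eigenvector

-- Shifting all slopes by t changes the constant by k t, so the constant may be taken in [0, k).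
record Normal (n k : ℕ) (v : Subset n → ℤ) : Set where
  constructor normal
  field
    q        : ℕ
    q<k      : q ℕ.< k
    c        : Vec ℤ n
    values   : ∀ p → ∣ p ∣ ≡ k → v p ≡ + q + σ c p
    balanced : + n * + q + + k * σ c full ≡ 0ℤ

σ-shift : ∀ {n} t (d : Vec ℤ n) p → σ (Vec.map (_+ t) d) p ≡ + ∣ p ∣ * t + σ d p
σ-shift t []      []            = refl
σ-shift t (x ∷ d) (inside ∷ p)  = trans (cong (_+_ (x + t)) (σ-shift t d p)) (shuffle x t (+ ∣ p ∣) (σ d p))
  where
  shuffle : ∀ x t m s → x + t + (m * t + s) ≡ (1ℤ + m) * t + (x + s)
  shuffle = solve-∀
σ-shift t (x ∷ d) (outside ∷ p) = σ-shift t d p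

normalise : ∀ {n k′ v} → Affine n (suc k′) v → Normal n (suc k′) v
normalise {n} {k′} {v} (affine K d v≡ bal) = record
  { q        = q
  ; q<k      = n%ℕd<d K k
  ; c        = Vec.map (_+ t) d
  ; values   = λ p ∣p∣ → begin
      v p                              ≡⟨ v≡ p ∣p∣ ⟩
      K + σ d p                        ≡⟨ cong (_+ σ d p) K≡ ⟩
      + q + t * + k + σ d p            ≡⟨ shuffle₁ (+ q) t (+ k) (σ d p) ⟩
      + q + (+ k * t + σ d p)          ≡⟨ cong (λ m → + q + (+ m * t + σ d p)) ∣p∣ ⟨
      + q + (+ ∣ p ∣ * t + σ d p)      ≡⟨ cong (_+_ (+ q)) (σ-shift t d p) ⟨
      + q + σ (Vec.map (_+ t) d) p     ∎
  ; balanced = begin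
      + n * + q + + k * σ (Vec.map (_+ t) d) full    ≡⟨ cong (λ z → + n * + q + + k * z) (σ-shift t d full) ⟩
      + n * + q + + k * (+ ∣ full {n} ∣ * t + σ d full) ≡⟨ cong (λ m → + n * + q + + k * (+ m * t + σ d full)) (∣⊤∣≡n n) ⟩
      + n * + q + + k * (+ n * t + σ d full)         ≡⟨ shuffle₂ (+ n) (+ q) (+ k) t (σ d full) ⟩
      + n * (+ q + t * + k) + + k * σ d full         ≡⟨ cong (λ z → + n * z + + k * σ d full) K≡ ⟨
      + n * K + + k * σ d full                       ≡⟨ bal ⟩
      0ℤ ∎
  }
  where
  open ≡-Reasoning
  k = suc k′
  q = K %ℕ k
  t = K /ℕ k
  K≡ : K ≡ + q + t * + k
  K≡ = a≡a%ℕn+[a/ℕn]*n K k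
  shuffle₁ : ∀ q t k s → q + t * k + s ≡ q + (k * t + s)
  shuffle₁ = solve-∀
  shuffle₂ : ∀ n q k t s → n * q + k * (n * t + s) ≡ n * (q + t * k) + k * s
  shuffle₂ = solve-∀

-- Multiplicities of slopes and the pigeonhole bound

occ : ∀ {n} → ℤ → Vec ℤ n → ℕ
occ e = Vec.count (ℤ._≟ e)

occ-∷ : ∀ {n} e x (c : Vec ℤ n) → occ e c ℕ.≤ occ e (x ∷ c)
occ-∷ e x c with x ℤ.≟ e
... | yes _ = ℕ.n≤1+n _
... | no  _ = ℕ.≤-refl

occ-head : ∀ {n} x (c : Vec ℤ n) → occ x (x ∷ c) ≡ suc (occ x c)
occ-head x c with x ℤ.≟ x
... | yes _  = refl
... | no x≢x = ⊥-elim (x≢x refl)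

occ-map : ∀ {n} (f : ℤ → ℤ) {e g} → (∀ x → f x ≡ e → x ≡ g) → ∀ (c : Vec ℤ n) →
          occ e (Vec.map f c) ℕ.≤ occ g c
occ-map f inv [] = ℕ.z≤n
occ-map f {e} {g} inv (x ∷ c) with f x ℤ.≟ e | x ℤ.≟ g
... | yes _  | yes _  = ℕ.s≤s (occ-map f inv c)
... | yes eq | no x≢g = ⊥-elim (x≢g (inv x eq))
... | no _   | yes _  = ℕ.m≤n⇒m≤1+n (occ-map f inv c)
... | no _   | no _   = occ-map f inv c

-- Since e₁ and e₂ differ, no coordinate belongs to both supplies, and one pass over `c` can draw
-- from each independently.
choose : ∀ {n} (c : Vec ℤ n) {e₁ e₂} → e₁ ≢ e₂ → ∀ i j → i ℕ.≤ occ e₁ c → j ℕ.≤ occ e₂ c →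
         ∃ λ p → ∣ p ∣ ≡ i ℕ.+ j × σ c p ≡ + i * e₁ + + j * e₂
choose []      ne zero zero _ _ = [] , refl , refl
choose (x ∷ c) {e₁} {e₂} ne i j i≤ j≤ with x ℤ.≟ e₁ | x ℤ.≟ e₂
... | yes refl | yes refl = ⊥-elim (ne refl)
... | no _     | no _     with p , ∣p∣ , eq ← choose c ne i j i≤ j≤ = outside ∷ p , ∣p∣ , eq
choose (x ∷ c) ne zero j i≤ j≤ | yes refl | no _
  with p , ∣p∣ , eq ← choose c ne zero j ℕ.z≤n j≤ = outside ∷ p , ∣p∣ , eq
choose (x ∷ c) {e₁} {e₂} ne (suc i) j (ℕ.s≤s i≤) j≤ | yes refl | no _
  with p , ∣p∣ , eq ← choose c ne i j i≤ j≤ =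
  inside ∷ p , cong suc ∣p∣ , trans (cong (_+_ x) eq) (shuffle x e₂ (+ i) (+ j))
  where
  shuffle : ∀ x y i j → x + (i * x + j * y) ≡ (1ℤ + i) * x + j * y
  shuffle = solve-∀
choose (x ∷ c) ne i zero i≤ j≤ | no _ | yes refl
  with p , ∣p∣ , eq ← choose c ne i zero i≤ ℕ.z≤n = outside ∷ p , ∣p∣ , eq
choose (x ∷ c) {e₁} {e₂} ne i (suc j) i≤ (ℕ.s≤s j≤) | no _ | yes refl
  with p , ∣p∣ , eq ← choose c ne i j i≤ j≤ =
  inside ∷ p , trans (cong suc ∣p∣) (sym (ℕ.+-suc i j)) , trans (cong (_+_ x) eq) (shuffle x e₁ (+ i) (+ j))
  where
  shuffle : ∀ y x i j → y + (i * x + j * y) ≡ i * x + (1ℤ + j) * y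
  shuffle = solve-∀

-- The number of coordinates with slope in [0, M), split by value so that a bound on each
-- multiplicity is multiplied by M.
band : ∀ {n} → ℕ → Vec ℤ n → ℕ
band zero    c = 0
band (suc M) c = occ (+ M) c ℕ.+ band M c

band-∷ : ∀ {n} M x (c : Vec ℤ n) → band M c ℕ.≤ band M (x ∷ c)
band-∷ zero    x c = ℕ.z≤n
band-∷ (suc M) x c = ℕ.+-mono-≤ (occ-∷ (+ M) x c) (band-∷ M x c)

band-head : ∀ {n} {M a} → a ℕ.< M → ∀ (c : Vec ℤ n) → suc (band M c) ℕ.≤ band M (+ a ∷ c)
band-head {M = suc M} {a} a<M c with ℕ.m≤n⇒m<n∨m≡n (ℕ.≤-pred a<M)
... | inj₂ refl rewrite occ-head (+ M) c = ℕ.s≤s (ℕ.+-monoʳ-≤ (occ (+ M) c) (band-∷ M (+ M) c))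
... | inj₁ a<M′ = ℕ.≤-trans (ℕ.≤-reflexive (sym (ℕ.+-suc (occ (+ M) c) (band M c))))
  (ℕ.+-mono-≤ (occ-∷ (+ M) (+ a) c) (band-head a<M′ c))

band-≤ : ∀ {n} M b (c : Vec ℤ n) → (∀ {a} → a ℕ.< M → occ (+ a) c ℕ.≤ b) → band M c ℕ.≤ M ℕ.* b
band-≤ zero    b c le = ℕ.z≤n
band-≤ (suc M) b c le = ℕ.+-mono-≤ (le ℕ.≤-refl) (band-≤ M b c (λ a<M → le (ℕ.m≤n⇒m≤1+n a<M)))

data OutsideBelow (M : ℤ) : ∀ {n} → Subset n → Vec ℤ n → Set where
  []   : OutsideBelow M [] []
  in∷  : ∀ {n x} {p : Subset n} {c} → OutsideBelow M p c → OutsideBelow M (inside ∷ p) (x ∷ c)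
  out∷ : ∀ {n x} {p : Subset n} {c} → x < M → OutsideBelow M p c → OutsideBelow M (outside ∷ p) (x ∷ c)

outsideBelow-full : ∀ {n} M (c : Vec ℤ n) → OutsideBelow M full c
outsideBelow-full M []      = []
outsideBelow-full M (x ∷ c) = in∷ (outsideBelow-full M c)

σ-zero : ∀ {n} (c : Vec ℤ n) p → ∣ p ∣ ≡ 0 → σ c p ≡ 0ℤ
σ-zero []      []            eq = refl
σ-zero (x ∷ c) (outside ∷ p) eq = σ-zero c p eq

-- A greedy scan takes slopes of at least M until k are taken. If places remain, every such slope
-- has been taken, and the spare places are filled once they equal the number of coordinates left.
threshold : ∀ {n k} (M : ℤ) (c : Vec ℤ n) → k ℕ.≤ n →
            ∃ λ p → ∣ p ∣ ≡ k × (+ k * M ≤ σ c p ⊎ OutsideBelow M p c)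
threshold {n} {zero} M c _ with p , ∣p∣ ← subset-of-size {n} ℕ.z≤n =
  p , ∣p∣ , inj₁ (ℤ.≤-reflexive (sym (σ-zero c p ∣p∣)))
threshold {suc n} {suc k} M (x ∷ c) (ℕ.s≤s k≤n) with x ℤ.<? M
... | no x≮M with threshold M c k≤n
...   | p , ∣p∣ , inj₁ le  = inside ∷ p , cong suc ∣p∣ ,
          inj₁ (ℤ.≤-trans (ℤ.≤-reflexive (ℤ.suc-* (+ k) M)) (ℤ.+-mono-≤ (ℤ.≮⇒≥ x≮M) le))
...   | p , ∣p∣ , inj₂ out = inside ∷ p , cong suc ∣p∣ , inj₂ (in∷ out)
threshold {suc n} {suc k} M (x ∷ c) (ℕ.s≤s k≤n) | yes x<M with ℕ.m≤n⇒m<n∨m≡n k≤n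
... | inj₂ refl = full , ∣⊤∣≡n (suc n) , inj₂ (outsideBelow-full M (x ∷ c))
... | inj₁ k<n with threshold {k = suc k} M c k<n
...   | p , ∣p∣ , inj₁ le  = outside ∷ p , ∣p∣ , inj₁ le
...   | p , ∣p∣ , inj₂ out = outside ∷ p , ∣p∣ , inj₂ (out∷ x<M out)

module _ {k q : ℕ} (q<k : q ℕ.< k) (M : ℕ) where

  private
    height : ℤ
    height = + (k ℕ.* M)

    -- A negative x gives q + k x ≤ - 1 because q < k, so after adding 1 it costs nothing; a slope
    -- in [0, M) costs at most k M. The added 1 is what counts coordinates when these bounds are
    -- summed.
    charge : ∀ {n} x (c : Vec ℤ n) → x < + M →
             ∃ λ δ → δ ℕ.+ band M c ℕ.≤ band M (x ∷ c) × 1ℤ + + q + + k * x ≤ height * + δ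
    charge -[1+ a ] c _ = 0 , band-∷ M -[1+ a ] c , ℤ.≤-trans
      (ℤ.+-mono-≤ (+≤+ q<k) (ℤ.*-monoˡ-≤-nonNeg (+ k) (-≤- ℕ.z≤n)))
      (ℤ.≤-reflexive (shuffle (+ k) height))
      where
      shuffle : ∀ k h → k + k * (- 1ℤ) ≡ h * 0ℤ
      shuffle = solve-∀
    charge (+ a) c (+<+ a<M) = 1 , band-head a<M c , ℤ.≤-trans
      (ℤ.+-monoˡ-≤ (+ k * + a) (+≤+ q<k))
      (ℤ.≤-trans (ℤ.≤-reflexive (shuffle (+ k) (+ a)))
        (ℤ.≤-trans (ℤ.*-monoˡ-≤-nonNeg (+ k) (+≤+ a<M))
          (ℤ.≤-reflexive (trans (sym (ℤ.pos-* k M)) (sym (ℤ.*-identityʳ height))))))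
      where
      shuffle : ∀ k a → k + k * a ≡ k * (1ℤ + a)
      shuffle = solve-∀

  outside-sum : ∀ {n m e} {p : Subset n} → Sized p m e → ∀ c → OutsideBelow (+ M) p c →
                + e * (1ℤ + + q) + + k * (σ c full - σ c p) ≤ height * + band M c
  outside-sum [] [] [] = ℤ.≤-trans (ℤ.≤-reflexive (trans (ℤ.+-identityˡ _) (ℤ.*-zeroʳ (+ k))))
    (ℤ.≤-trans (+≤+ ℕ.z≤n) (ℤ.≤-reflexive (ℤ.pos-* (k ℕ.* M) (band M []))))
  outside-sum {e = e} {inside ∷ p} (in∷ s) (x ∷ c) (in∷ out) = ℤ.≤-trans
    (ℤ.≤-reflexive (shuffle (+ e) (+ q) (+ k) x (σ c full) (σ c p)))
    (ℤ.≤-trans (outside-sum s c out) (ℤ.*-monoˡ-≤-nonNeg height (+≤+ (band-∷ M x c))))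
    where
    shuffle : ∀ e q k x t s → e * (1ℤ + q) + k * (x + t - (x + s)) ≡ e * (1ℤ + q) + k * (t - s)
    shuffle = solve-∀
  outside-sum {e = suc e} {outside ∷ p} (out∷ s) (x ∷ c) (out∷ x<M out) with charge x c x<M
  ... | δ , δ≤ , le = ℤ.≤-trans
    (ℤ.≤-reflexive (shuffle (+ e) (+ q) (+ k) x (σ c full) (σ c p)))
    (ℤ.≤-trans (ℤ.+-mono-≤ le (outside-sum s c out))
      (ℤ.≤-trans (ℤ.≤-reflexive (sym (ℤ.*-distribˡ-+ height (+ δ) (+ band M c))))
        (ℤ.*-monoˡ-≤-nonNeg height (+≤+ δ≤))))
    where
    shuffle : ∀ e q k x t s → (1ℤ + e) * (1ℤ + q) + k * (x + t - s) ≡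
              1ℤ + q + k * x + (e * (1ℤ + q) + k * (t - s))
    shuffle = solve-∀

private
  -- The left sides of the two bounds add up to n = k + e plus the total of all q + k x, which the
  -- balance makes 0.
  combine : ∀ k e q t s X Y → (k + e) * q + k * t ≡ 0ℤ → e * (1ℤ + q) + k * (t - s) ≤ X →
            k * (1ℤ + (q + s)) ≤ Y → k + e ≤ X + Y
  combine k e q t s X Y bal le₁ le₂ = ≤-transfer (ℤ.+-mono-≤ le₁ le₂)
    (trans (shuffle k e q t s X Y)
      (trans (cong (λ z → X + Y - (k + e) - z) bal) (ℤ.+-identityʳ (X + Y - (k + e)))))
    where
    shuffle : ∀ k e q t s X Y → X + Y - (e * (1ℤ + q) + k * (t - s) + k * (1ℤ + (q + s))) ≡
              X + Y - (k + e) - ((k + e) * q + k * t)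
    shuffle = solve-∀

-- If no value in [0, M) is frequent, the threshold set p leaves at most M k′
-- coordinates with q + k x ≥ 0 outside it; as all q + k x sum to 0, this bounds n.
frequent-value : ∀ {n k′ q} M → (c : Vec ℤ n) → q ℕ.< suc k′ → suc k′ ℕ.≤ n →
  + n * + q + + suc k′ * σ c full ≡ 0ℤ →
  (∀ p → ∣ p ∣ ≡ suc k′ → + q + σ c p < + (suc k′ ℕ.* M)) →
  suc k′ ℕ.* M ℕ.* (M ℕ.* k′) ℕ.+ suc k′ ℕ.* (suc k′ ℕ.* M) ℕ.+ suc k′ ℕ.≤ n →
  ∃ λ a → suc k′ ℕ.≤ occ (+ a) c
frequent-value {n} {k′} {q} M c q<k k≤n bal bound large
  with ℕ.anyUpTo? (λ a → suc k′ ℕ.≤? occ (+ a) c) M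
... | yes (a , _ , freq) = a , freq
... | no rare with threshold {k = suc k′} (+ M) c k≤n
...   | p , ∣p∣ , inj₁ le = ⊥-elim (ℤ.<⇒≱ (bound p ∣p∣) (ℤ.≤-trans
          (ℤ.≤-reflexive (ℤ.pos-* (suc k′) M)) (ℤ.≤-trans le (ℤ.i≤j+i (σ c p) (+ q)))))
...   | p , ∣p∣ , inj₂ out with e , n≡ ← ℕ.m≤n⇒∃[o]m+o≡n k≤n =
  -- The counting gives n ≤ X + Y, whereas `large` asks for k more.
  ⊥-elim (ℕ.<⇒≱ (ℕ.≤-<-trans n≤ (ℕ.m<m+n _ (ℕ.s≤s ℕ.z≤n))) large)
  where
  k X Y : ℕ
  k = suc k′
  X = k ℕ.* M ℕ.* (M ℕ.* k′)
  Y = k ℕ.* (k ℕ.* M)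
  split : Sized p k e
  split = sized p e ∣p∣ n≡
  le₁ : + e * (1ℤ + + q) + + k * (σ c full - σ c p) ≤ + X
  le₁ = ℤ.≤-trans (outside-sum q<k M split c out) (ℤ.≤-trans
    (ℤ.≤-reflexive (sym (ℤ.pos-* (k ℕ.* M) (band M c))))
    (+≤+ (ℕ.*-monoʳ-≤ (k ℕ.* M) (band-≤ M k′ c (λ a<M → ℕ.≮⇒≥ (λ freq → rare (_ , a<M , freq)))))))
  le₂ : + k * (1ℤ + (+ q + σ c p)) ≤ + Y
  le₂ = ℤ.≤-trans (ℤ.*-monoˡ-≤-nonNeg (+ k) (ℤ.i<j⇒suc[i]≤j (bound p ∣p∣)))
    (ℤ.≤-reflexive (sym (ℤ.pos-* k (k ℕ.* M))))
  n≤ : n ℕ.≤ X ℕ.+ Y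
  n≤ = subst (ℕ._≤ X ℕ.+ Y) n≡ (ℤ.drop‿+≤+ (combine (+ k) (+ e) (+ q) (σ c full) (σ c p) (+ X) (+ Y)
    (subst (λ m → + m * + q + + k * σ c full ≡ 0ℤ) (sym n≡) bal) le₁ le₂))

-- Negative slopes by reflection

σ-reflect : ∀ {n} t (c : Vec ℤ n) p → σ (Vec.map (_-_ t) c) p ≡ + ∣ p ∣ * t - σ c p
σ-reflect t []      []            = refl
σ-reflect t (x ∷ c) (inside ∷ p)  = trans (cong (_+_ (t - x)) (σ-reflect t c p)) (shuffle x t (+ ∣ p ∣) (σ c p))
  where
  shuffle : ∀ x t m s → t - x + (m * t - s) ≡ (1ℤ + m) * t - (x + s)
  shuffle = solve-∀
σ-reflect t (x ∷ c) (outside ∷ p) = σ-reflect t c p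

-- Negating the eigenvector turns (q , c) into (− q − k t , t − c), where t is
-- chosen so that the new constant lies again in [0, k).
frequent-negative : ∀ {n k′ q} M → (c : Vec ℤ n) → q ℕ.< suc k′ → suc k′ ℕ.≤ n →
  + n * + q + + suc k′ * σ c full ≡ 0ℤ →
  (∀ p → ∣ p ∣ ≡ suc k′ → - (+ q + σ c p) < + (suc k′ ℕ.* M)) →
  suc k′ ℕ.* M ℕ.* (M ℕ.* k′) ℕ.+ suc k′ ℕ.* (suc k′ ℕ.* M) ℕ.+ suc k′ ℕ.≤ n →
  ∃ λ b → (suc k′ ℕ.≤ occ (- + b) c) × (q ≡ 0 ⊎ b ≢ 0)
frequent-negative {n} {k′} {q} M c q<k k≤n bal bound large = by-sign q refl
  where
  reflected : ∀ t q′ → + q′ ≡ - + q - + suc k′ * t → q′ ℕ.< suc k′ → ∃ λ a → suc k′ ℕ.≤ occ (t - + a) c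
  reflected t q′ q′≡ q′<k = let a , freq = frequent-value M (Vec.map (_-_ t) c) q′<k k≤n bal′ bound′ large
    in a , ℕ.≤-trans freq (occ-map (_-_ t) (λ x eq → trans (shuffle x t) (cong (_-_ t) eq)) c)
    where
    shuffle : ∀ x t → x ≡ t - (t - x)
    shuffle = solve-∀
    bal′ : + n * + q′ + + suc k′ * σ (Vec.map (_-_ t) c) full ≡ 0ℤ
    bal′ = trans (cong₂ (λ a b → + n * a + + suc k′ * b) q′≡
        (trans (σ-reflect t c full) (cong (λ m → + m * t - σ c full) (∣⊤∣≡n n))))
      (trans (shuffle′ (+ n) (+ q) (+ suc k′) t (σ c full)) (cong -_ bal))
      where
      shuffle′ : ∀ n q k t s → n * (- q - k * t) + k * (n * t - s) ≡ - (n * q + k * s)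
      shuffle′ = solve-∀
    bound′ : ∀ p → ∣ p ∣ ≡ suc k′ → + q′ + σ (Vec.map (_-_ t) c) p < + (suc k′ ℕ.* M)
    bound′ p ∣p∣ = subst (_< + (suc k′ ℕ.* M)) (sym (trans
        (cong₂ _+_ q′≡ (trans (σ-reflect t c p) (cong (λ m → + m * t - σ c p) ∣p∣)))
        (shuffle′ (+ q) (+ suc k′) t (σ c p)))) (bound p ∣p∣)
      where
      shuffle′ : ∀ q k t s → - q - k * t + (k * t - s) ≡ - (q + s)
      shuffle′ = solve-∀
  by-sign : ∀ m → m ≡ q → ∃ λ b → (suc k′ ℕ.≤ occ (- + b) c) × (q ≡ 0 ⊎ b ≢ 0)
  -- For q = 0 the shift is 0 and b may come out as 0; that case is excluded later, because it would
  -- give v a zero.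
  by-sign zero refl =
    let a , freq = reflected 0ℤ 0 (sym (trans (ℤ.+-identityˡ _) (cong -_ (ℤ.*-zeroʳ (+ suc k′))))) q<k
    in a , subst (λ z → suc k′ ℕ.≤ occ z c) (ℤ.+-identityˡ (- + a)) freq , inj₁ refl
  -- For q > 0 the shift - 1 gives the constant k - q. A reflected slope a comes from - 1 - a, so b
  -- = a + 1 is nonzero.
  by-sign (suc m) refl =
    let a , freq = reflected (- 1ℤ) (suc k′ ∸ suc m) eq (ℕ.s≤s (ℕ.m∸n≤m k′ m))
    in suc a , subst (λ z → suc k′ ℕ.≤ occ z c) (shuffle (+ a)) freq , inj₂ (λ ())
    where
    shuffle : ∀ a → - 1ℤ - a ≡ - (1ℤ + a)
    shuffle = solve-∀
    shuffle′ : ∀ k q → k - q ≡ - q - k * (- 1ℤ)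
    shuffle′ = solve-∀
    eq : + (suc k′ ∸ suc m) ≡ - + suc m - + suc k′ * (- 1ℤ)
    eq = trans (sym (ℤ.⊖-≥ (ℕ.<⇒≤ q<k))) (trans (sym (ℤ.m-n≡m⊖n (suc k′) (suc m))) (shuffle′ (+ suc k′) (+ suc m)))

-- Rational values and the size of T

ℕtoℚ-ᵘ : ∀ m → ℚ.toℚᵘ (ℕtoℚ m) ℚᵘ.≃ ℚᵘ.mkℚᵘ (+ m) 0
ℕtoℚ-ᵘ m = ℚ.toℚᵘ-fromℚᵘ (ℚᵘ.mkℚᵘ (+ m) 0)

ℕtoℚ-+ : ∀ m n → ℕtoℚ (m ℕ.+ n) ≡ ℕtoℚ m ℚ.+ ℕtoℚ n
ℕtoℚ-+ m n = ℚ.toℚᵘ-injective (begin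
  ℚ.toℚᵘ (ℕtoℚ (m ℕ.+ n))                      ≈⟨ ℕtoℚ-ᵘ (m ℕ.+ n) ⟩
  ℚᵘ.mkℚᵘ (+ (m ℕ.+ n)) 0                      ≈⟨ ℚᵘ.*≡* (shuffle (+ m) (+ n)) ⟩
  ℚᵘ.mkℚᵘ (+ m) 0 ℚᵘ.+ ℚᵘ.mkℚᵘ (+ n) 0         ≈⟨ ℚᵘ.+-cong (ℕtoℚ-ᵘ m) (ℕtoℚ-ᵘ n) ⟨
  ℚ.toℚᵘ (ℕtoℚ m) ℚᵘ.+ ℚ.toℚᵘ (ℕtoℚ n)         ≈⟨ ℚ.toℚᵘ-homo-+ (ℕtoℚ m) (ℕtoℚ n) ⟨
  ℚ.toℚᵘ (ℕtoℚ m ℚ.+ ℕtoℚ n)                   ∎)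
  where
  open import Relation.Binary.Reasoning.Setoid ℚᵘ.≃-setoid
  shuffle : ∀ a b → (a + b) * (1ℤ * 1ℤ) ≡ (a * 1ℤ + b * 1ℤ) * 1ℤ
  shuffle = solve-∀

-- All that is needed of fractions: both k (r/s) and k (j²/k) are natural numbers.
ℕtoℚ-*-frac : ∀ k p d q → k ℕ.* p ≡ suc d ℕ.* q → ℕtoℚ k ℚ.* frac p (suc d) ≡ ℕtoℚ q
ℕtoℚ-*-frac k p d q eq = ℚ.toℚᵘ-injective (begin
  ℚ.toℚᵘ (ℕtoℚ k ℚ.* frac p (suc d))           ≈⟨ ℚ.toℚᵘ-homo-* (ℕtoℚ k) (frac p (suc d)) ⟩
  ℚ.toℚᵘ (ℕtoℚ k) ℚᵘ.* ℚ.toℚᵘ (frac p (suc d)) ≈⟨ ℚᵘ.*-cong (ℕtoℚ-ᵘ k) (ℚ.toℚᵘ-fromℚᵘ (ℚᵘ.mkℚᵘ (+ p) d)) ⟩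
  ℚᵘ.mkℚᵘ (+ k) 0 ℚᵘ.* ℚᵘ.mkℚᵘ (+ p) d         ≈⟨ ℚᵘ.*≡* (cross eq) ⟩
  ℚᵘ.mkℚᵘ (+ q) 0                              ≈⟨ ℕtoℚ-ᵘ q ⟨
  ℚ.toℚᵘ (ℕtoℚ q)                              ∎)
  where
  open import Relation.Binary.Reasoning.Setoid ℚᵘ.≃-setoid
  cross : k ℕ.* p ≡ suc d ℕ.* q → + k * + p * 1ℤ ≡ + q * (1ℤ * + suc d)
  cross eq = trans (cong (_* 1ℤ) (trans (sym (ℤ.pos-* k p)) (trans (cong +_ eq) (ℤ.pos-* (suc d) q))))
    (shuffle (+ suc d) (+ q))
    where
    shuffle : ∀ d q → d * q * 1ℤ ≡ q * (1ℤ * d)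
    shuffle = solve-∀

ℕtoℚ-* : ∀ m n → ℕtoℚ m ℚ.* ℕtoℚ n ≡ ℕtoℚ (m ℕ.* n)
ℕtoℚ-* m n = ℕtoℚ-*-frac m n 0 (m ℕ.* n) (sym (ℕ.+-identityʳ _))

ℕtoℚ-mono-≤ : ∀ {m n} → m ℕ.≤ n → ℕtoℚ m ℚ.≤ ℕtoℚ n
ℕtoℚ-mono-≤ {m} {n} m≤n = ℚ.toℚᵘ-cancel-≤ (begin
  ℚ.toℚᵘ (ℕtoℚ m)    ≃⟨ ℕtoℚ-ᵘ m ⟩
  ℚᵘ.mkℚᵘ (+ m) 0    ≤⟨ ℚᵘ.*≤* (ℤ.*-monoʳ-≤-nonNeg 1ℤ (+≤+ m≤n)) ⟩
  ℚᵘ.mkℚᵘ (+ n) 0    ≃⟨ ℕtoℚ-ᵘ n ⟨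
  ℚ.toℚᵘ (ℕtoℚ n)    ∎)
  where open ℚᵘ.≤-Reasoning

ℕtoℚ-cancel-< : ∀ {m n} → ℕtoℚ m ℚ.< ℕtoℚ n → m ℕ.< n
ℕtoℚ-cancel-< lt = ℕ.≰⇒> (λ n≤m → ℚ.<-irrefl refl (ℚ.<-≤-trans lt (ℕtoℚ-mono-≤ n≤m)))

-- When k r = s q the two entries of the maximum are k a + q and k b - q. In the second hypothesis q
-- stands on the right to avoid truncated subtraction.
valB-≤ : ∀ k a b r s q u → 0 ℕ.< s → k ℕ.* r ≡ s ℕ.* q → k ℕ.* a ℕ.+ q ℕ.≤ u → k ℕ.* b ℕ.≤ u ℕ.+ q →
         valB k a b r s ℚ.≤ ℕtoℚ u
valB-≤ k a b r (suc d) q u _ eq a≤ b≤ = ℚ.⊔-lub left right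
  where
  open ℚ.≤-Reasoning
  f = frac r (suc d)
  left : ℕtoℚ k ℚ.* (ℕtoℚ a ℚ.+ f) ℚ.≤ ℕtoℚ u
  left = begin
    ℕtoℚ k ℚ.* (ℕtoℚ a ℚ.+ f)             ≡⟨ ℚ.*-distribˡ-+ (ℕtoℚ k) (ℕtoℚ a) f ⟩
    ℕtoℚ k ℚ.* ℕtoℚ a ℚ.+ ℕtoℚ k ℚ.* f    ≡⟨ cong₂ ℚ._+_ (ℕtoℚ-* k a) (ℕtoℚ-*-frac k r d q eq) ⟩
    ℕtoℚ (k ℕ.* a) ℚ.+ ℕtoℚ q             ≡⟨ ℕtoℚ-+ (k ℕ.* a) q ⟨
    ℕtoℚ (k ℕ.* a ℕ.+ q)                  ≤⟨ ℕtoℚ-mono-≤ a≤ ⟩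
    ℕtoℚ u                                ∎
  cancel : ∀ K b f Q → K ℚ.* f ≡ Q → K ℚ.* (b ℚ.- f) ≡ K ℚ.* b ℚ.- Q
  cancel K b f _ refl = solve 3 (λ K b f → K :* (b :- f) := K :* b :- K :* f) refl K b f
    where open ℚ.+-*-Solver
  right : ℕtoℚ k ℚ.* (ℕtoℚ b ℚ.- f) ℚ.≤ ℕtoℚ u
  right = begin
    ℕtoℚ k ℚ.* (ℕtoℚ b ℚ.- f)             ≡⟨ cancel (ℕtoℚ k) (ℕtoℚ b) f (ℕtoℚ q) (ℕtoℚ-*-frac k r d q eq) ⟩
    ℕtoℚ k ℚ.* ℕtoℚ b ℚ.- ℕtoℚ q          ≡⟨ cong (ℚ._- ℕtoℚ q) (ℕtoℚ-* k b) ⟩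
    ℕtoℚ (k ℕ.* b) ℚ.- ℕtoℚ q             ≤⟨ ℚ.+-monoˡ-≤ (ℚ.- ℕtoℚ q) (ℕtoℚ-mono-≤ b≤) ⟩
    ℕtoℚ (u ℕ.+ q) ℚ.- ℕtoℚ q             ≡⟨ cong (ℚ._- ℕtoℚ q) (ℕtoℚ-+ u q) ⟩
    ℕtoℚ u ℚ.+ ℕtoℚ q ℚ.- ℕtoℚ q          ≡⟨ solve 2 (λ u q → u :+ q :- q := u) refl (ℕtoℚ u) (ℕtoℚ q) ⟩
    ℕtoℚ u                                ∎
    where open ℚ.+-*-Solver

-- Multiplying by k clears j²/k, and moving the subtracted terms to the side of n leaves an
-- inequality between naturals.
T-bound : ∀ {n k′} γ → let k = suc k′ ; j = jval k γ in T k γ ℚ.< ℕtoℚ n →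
  k ℕ.* (j ℕ.* j ℕ.+ 2 ℕ.* k ℕ.* j ℕ.+ 3 ℕ.* k) ℕ.< k ℕ.* n ℕ.+ (k ℕ.* j ℕ.+ j ℕ.* j)
T-bound {n} {k′} γ lt = clear (jval k γ) lt
  where
  k = suc k′
  open ℚ.≤-Reasoning
  clear : ∀ j → ℕtoℚ (j ℕ.* j ℕ.+ 2 ℕ.* k ℕ.* j ℕ.+ 3 ℕ.* k) ℚ.- ℕtoℚ j ℚ.- frac (j ℕ.* j) k ℚ.< ℕtoℚ n →
    k ℕ.* (j ℕ.* j ℕ.+ 2 ℕ.* k ℕ.* j ℕ.+ 3 ℕ.* k) ℕ.< k ℕ.* n ℕ.+ (k ℕ.* j ℕ.+ j ℕ.* j)
  clear j lt = ℕtoℚ-cancel-< (begin-strict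
    ℕtoℚ (k ℕ.* P)                           ≡⟨ ℕtoℚ-* k P ⟨
    K ℚ.* ℕtoℚ P                             ≡⟨ solve 4 (λ K P j f → K :* P := K :* (P :- j :- f) :+ (K :* j :+ K :* f)) refl K (ℕtoℚ P) (ℕtoℚ j) f ⟩
    K ℚ.* (ℕtoℚ P ℚ.- ℕtoℚ j ℚ.- f) ℚ.+ (K ℚ.* ℕtoℚ j ℚ.+ K ℚ.* f)
      <⟨ ℚ.+-monoˡ-< (K ℚ.* ℕtoℚ j ℚ.+ K ℚ.* f) (ℚ.*-monoʳ-<-pos K lt) ⟩
    K ℚ.* ℕtoℚ n ℚ.+ (K ℚ.* ℕtoℚ j ℚ.+ K ℚ.* f)
      ≡⟨ cong₂ ℚ._+_ (ℕtoℚ-* k n) (cong₂ ℚ._+_ (ℕtoℚ-* k j) (ℕtoℚ-*-frac k (j ℕ.* j) k′ (j ℕ.* j) refl)) ⟩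
    ℕtoℚ (k ℕ.* n) ℚ.+ (ℕtoℚ (k ℕ.* j) ℚ.+ ℕtoℚ (j ℕ.* j))
      ≡⟨ cong (ℕtoℚ (k ℕ.* n) ℚ.+_) (ℕtoℚ-+ (k ℕ.* j) (j ℕ.* j)) ⟨
    ℕtoℚ (k ℕ.* n) ℚ.+ ℕtoℚ (k ℕ.* j ℕ.+ j ℕ.* j)
      ≡⟨ ℕtoℚ-+ (k ℕ.* n) (k ℕ.* j ℕ.+ j ℕ.* j) ⟨
    ℕtoℚ (k ℕ.* n ℕ.+ (k ℕ.* j ℕ.+ j ℕ.* j)) ∎)
    where
    open ℚ.+-*-Solver
    P = j ℕ.* j ℕ.+ 2 ℕ.* k ℕ.* j ℕ.+ 3 ℕ.* k
    K = ℕtoℚ k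
    f = frac (j ℕ.* j) k
    instance
      K>0 : ℚ.Positive K
      K>0 = ℚ.normalize-pos k 1

-- At j = 2 k M the part j² - j²/k of T is 4 k k′ M², four times the leading term of the required
-- bound. Larger j only adds nonnegative slack.
T-large : ∀ {n k′ M} γ → 2 ℕ.* suc k′ ℕ.* M ℕ.≤ jval (suc k′) γ → T (suc k′) γ ℚ.< ℕtoℚ n →
          suc k′ ℕ.* M ℕ.* (M ℕ.* k′) ℕ.+ suc k′ ℕ.* (suc k′ ℕ.* M) ℕ.+ suc k′ ℕ.≤ n
T-large {n} {k′} {M} γ 2kM≤j lt = ℕ.≮⇒≥ λ n<L →
  ℕ.<⇒≱ (T-bound {n} {k′} γ lt) (impossible (jval (suc k′) γ) 2kM≤j (ℕ.<⇒≤ n<L))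
  where
  open ℕ.≤-Reasoning
  k L : ℕ
  k = suc k′
  L = k ℕ.* M ℕ.* (M ℕ.* k′) ℕ.+ k ℕ.* (k ℕ.* M) ℕ.+ k
  -- The exact difference of the two sides at j = 2 k M + d.
  slack : ℕ → ℕ
  slack d = k′ ℕ.* (3 ℕ.* k ℕ.* k ℕ.* M ℕ.* M ℕ.+ 4 ℕ.* k ℕ.* M ℕ.* d ℕ.+ d ℕ.* d)
    ℕ.+ k ℕ.* k ℕ.* M ℕ.* (3 ℕ.* k′ ℕ.+ 1) ℕ.+ k ℕ.* d ℕ.* (2 ℕ.* k′ ℕ.+ 1) ℕ.+ 2 ℕ.* k ℕ.* k
  expand : ∀ k′ M d → let k = 1 ℕ.+ k′ ; j = 2 ℕ.* k ℕ.* M ℕ.+ d in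
    k ℕ.* (j ℕ.* j ℕ.+ 2 ℕ.* k ℕ.* j ℕ.+ 3 ℕ.* k) ≡
    k ℕ.* (k ℕ.* M ℕ.* (M ℕ.* k′) ℕ.+ k ℕ.* (k ℕ.* M) ℕ.+ k) ℕ.+ (k ℕ.* j ℕ.+ j ℕ.* j) ℕ.+
    (k′ ℕ.* (3 ℕ.* k ℕ.* k ℕ.* M ℕ.* M ℕ.+ 4 ℕ.* k ℕ.* M ℕ.* d ℕ.+ d ℕ.* d)
    ℕ.+ k ℕ.* k ℕ.* M ℕ.* (3 ℕ.* k′ ℕ.+ 1) ℕ.+ k ℕ.* d ℕ.* (2 ℕ.* k′ ℕ.+ 1) ℕ.+ 2 ℕ.* k ℕ.* k)
  expand = ℕ.solve-∀
  impossible : ∀ j → 2 ℕ.* k ℕ.* M ℕ.≤ j → n ℕ.≤ L →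
    k ℕ.* n ℕ.+ (k ℕ.* j ℕ.+ j ℕ.* j) ℕ.≤ k ℕ.* (j ℕ.* j ℕ.+ 2 ℕ.* k ℕ.* j ℕ.+ 3 ℕ.* k)
  impossible j 2kM≤j n≤L with d , refl ← ℕ.m≤n⇒∃[o]m+o≡n 2kM≤j = begin
    k ℕ.* n ℕ.+ (k ℕ.* j ℕ.+ j ℕ.* j)              ≤⟨ ℕ.+-monoˡ-≤ (k ℕ.* j ℕ.+ j ℕ.* j) (ℕ.*-monoʳ-≤ k n≤L) ⟩
    k ℕ.* L ℕ.+ (k ℕ.* j ℕ.+ j ℕ.* j)              ≤⟨ ℕ.m≤m+n _ (slack d) ⟩
    k ℕ.* L ℕ.+ (k ℕ.* j ℕ.+ j ℕ.* j) ℕ.+ slack d  ≡⟨ expand k′ M d ⟨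
    k ℕ.* (j ℕ.* j ℕ.+ 2 ℕ.* k ℕ.* j ℕ.+ 3 ℕ.* k)  ∎

-- An explicit quadruple

-- For every n the quadruple (a, b, 0, 1) lies in B(n,k), with value k max(a, b) ≤ k M, so only
-- norms below k M need the structure of v. The condition 2 k M ≤ j makes n > T(k) sufficient for
-- the pigeonhole with this M.
record Witness (k γ : ℕ) : Set where
  constructor witness
  field
    {M a b} : ℕ
    2kM≤j   : 2 ℕ.* k ℕ.* M ℕ.≤ jval k γ
    b≢0     : b ≢ 0
    a≤M     : a ℕ.≤ M
    b≤M     : b ℕ.≤ M
    a+b∤bk  : ¬ (a ℕ.+ b ∣ b ℕ.* k)

-- For γ = 2h + 1 take b = h, since 2h k = γ k − k; for γ = 2h take b = h − 1,
-- since γ ∣ h k.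
even-split : ∀ {k γ} → 2 ∣ k → IsLeastNonDivisor k γ → ∃₂ λ a b →
             b ≢ 0 × a ℕ.≤ γ ℕ./ 2 ℕ.+ 1 × b ℕ.≤ γ ℕ./ 2 ℕ.+ 1 × ¬ (a ℕ.+ b ∣ b ℕ.* k)
even-split {k} {γ} 2∣k@(divides m k≡) (0<γ , γ∤k , _) =
  by-parity (γ ℕ.% 2) (γ ℕ./ 2) (ℕ.m%n<n γ 2) (ℕ.m≡m%n+[m/n]*n γ 2)
  where
  by-parity : ∀ ρ h → ρ ℕ.< 2 → γ ≡ ρ ℕ.+ h ℕ.* 2 → ∃₂ λ a b →
              b ≢ 0 × a ℕ.≤ h ℕ.+ 1 × b ℕ.≤ h ℕ.+ 1 × ¬ (a ℕ.+ b ∣ b ℕ.* k)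
  by-parity 0 0 _ γ≡ = ⊥-elim (ℕ.<⇒≢ 0<γ (sym γ≡))
  -- γ = 2 would make b = h - 1 vanish, but 2 divides the even k.
  by-parity 0 1 _ γ≡ = ⊥-elim (γ∤k (subst (_∣ k) (sym γ≡) 2∣k))
  by-parity 0 (suc (suc h)) _ γ≡ = 3 ℕ.+ h , 1 ℕ.+ h , (λ ()) , ℕ.≤-reflexive (ℕ.+-comm 1 (2 ℕ.+ h)) ,
    ℕ.≤-trans (ℕ.n≤1+n _) (ℕ.m≤m+n (2 ℕ.+ h) 1) , λ div → γ∤k (∣m+n∣m⇒∣n
      (divides m (trans (expand h k) (trans (cong ((2 ℕ.+ h) ℕ.*_) k≡) (trans (regroup h m) (cong (m ℕ.*_) (sym γ≡))))))
      (subst (_∣ (1 ℕ.+ h) ℕ.* k) (trans (a+b h) (sym γ≡)) div))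
    where
    expand : ∀ h k → (1 ℕ.+ h) ℕ.* k ℕ.+ k ≡ (2 ℕ.+ h) ℕ.* k
    expand = ℕ.solve-∀
    regroup : ∀ h m → (2 ℕ.+ h) ℕ.* (m ℕ.* 2) ≡ m ℕ.* ((2 ℕ.+ h) ℕ.* 2)
    regroup = ℕ.solve-∀
    a+b : ∀ h → 3 ℕ.+ h ℕ.+ (1 ℕ.+ h) ≡ (2 ℕ.+ h) ℕ.* 2
    a+b = ℕ.solve-∀
  by-parity 1 zero _ γ≡ = ⊥-elim (γ∤k (subst (_∣ k) (sym γ≡) (1∣ k)))
  by-parity 1 h@(suc _) _ γ≡ = h ℕ.+ 1 , h , (λ ()) , ℕ.≤-refl , ℕ.m≤m+n h 1 , λ div → γ∤k (∣m+n∣m⇒∣n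
      (divides k (trans (expand h k) (cong (k ℕ.*_) (sym γ≡))))
      (∣n⇒∣m*n 2 (subst (_∣ h ℕ.* k) (trans (a+b h) (sym γ≡)) div)))
    where
    expand : ∀ h k → 2 ℕ.* (h ℕ.* k) ℕ.+ k ≡ k ℕ.* (1 ℕ.+ h ℕ.* 2)
    expand = ℕ.solve-∀
    a+b : ∀ h → h ℕ.+ 1 ℕ.+ h ≡ 1 ℕ.+ h ℕ.* 2
    a+b = ℕ.solve-∀
  by-parity (suc (suc _)) _ (ℕ.s≤s (ℕ.s≤s ())) _

jval-odd : ∀ k γ {r} → k ℕ.% 2 ≡ suc r → jval k γ ≡ 2 ℕ.* k
jval-odd k γ eq rewrite eq = refl

jval-even : ∀ k γ → k ℕ.% 2 ≡ 0 → jval k γ ≡ (γ ℕ./ 2 ℕ.+ 1) ℕ.* (2 ℕ.* k ℕ.+ γ)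
jval-even k γ eq rewrite eq = refl

witness-exists : ∀ k γ → IsLeastNonDivisor k γ → Witness k γ
witness-exists k γ least with k ℕ.% 2 in k%2
-- For odd k, a + b = 2 does not divide k, and j = 2 k is exactly 2 k M for M = 1.
... | suc _ = witness {M = 1} {1} {1} (ℕ.≤-reflexive (trans (ℕ.*-identityʳ (2 ℕ.* k)) (sym (jval-odd k γ k%2))))
  (λ ()) ℕ.≤-refl ℕ.≤-refl λ 2∣1k →
  ℕ.0≢1+n (trans (sym (n∣m⇒m%n≡0 k 2 (subst (2 ∣_) (ℕ.*-identityˡ k) 2∣1k))) k%2)
... | zero =
  -- This M is the first factor of j, so j = M (2 k + γ) exceeds 2 k M by M γ.
  let M = γ ℕ./ 2 ℕ.+ 1
      a , b , b≢0 , a≤ , b≤ , ∤ = even-split (m%n≡0⇒n∣m k 2 k%2) least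
  in witness {M = M} {a} {b} (ℕ.≤-trans (ℕ.≤-reflexive (ℕ.*-comm (2 ℕ.* k) M))
       (ℕ.≤-trans (ℕ.*-monoʳ-≤ M (ℕ.m≤m+n (2 ℕ.* k) γ)) (ℕ.≤-reflexive (sym (jval-even k γ k%2))))) b≢0 a≤ b≤ ∤

witness-InB : ∀ n {k γ} (w : Witness k γ) → InB n k (Witness.a w) (Witness.b w) 0 1
witness-InB n {k} (witness {a = a} {b} _ b≢0 _ _ ∤) = b≢0 , ℕ.s≤s ℕ.z≤n , refl , 1∣ gcd n k , λ div →
  ∤ (subst₂ _∣_ (ℕ.*-identityˡ (a ℕ.+ b)) (cong (ℕ._* k) (ℕ.*-identityʳ b)) div)

-- Attained values and membership in B(n,k)

record LowestTerms (k q : ℕ) : Set where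
  field
    {r s}  : ℕ
    r<s    : r ℕ.< s
    gcd≡1  : gcd s r ≡ 1
    cross  : k ℕ.* r ≡ s ℕ.* q
    s∣k    : s ∣ k
    s∣n    : ∀ n t → n ℕ.* q ≡ k ℕ.* t → s ∣ n

-- Here r/s is q/k reduced by g = gcd(k, q). The balance has the form n q = k t up to sign;
-- cancelling g leaves n r = s t, and coprimality puts s into n. This is the source of the condition
-- s ∣ (n,k).
lowest-terms : ∀ {k q} → q ℕ.< k → LowestTerms k q
lowest-terms {k} {q} q<k = record
  { r<s   = ℕ.*-cancelʳ-< g r s (subst₂ ℕ._<_ (sym rg) (sym sg) q<k)
  ; gcd≡1 = coprime⇒gcd≡1 (coprime-/gcd k q)
  ; cross = trans (cong (ℕ._* r) (sym sg)) (trans (swap s g r) (cong (s ℕ.*_) rg))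
  ; s∣k   = divides g (trans (sym sg) (ℕ.*-comm s g))
  ; s∣n   = λ n t eq → coprime-divisor (coprime-/gcd k q) (divides t (ℕ.*-cancelʳ-≡ (r ℕ.* n) (t ℕ.* s) g (begin
      r ℕ.* n ℕ.* g       ≡⟨ swap′ r n g ⟩
      n ℕ.* (r ℕ.* g)     ≡⟨ cong (n ℕ.*_) rg ⟩
      n ℕ.* q             ≡⟨ eq ⟩
      k ℕ.* t             ≡⟨ cong (ℕ._* t) sg ⟨
      s ℕ.* g ℕ.* t       ≡⟨ swap″ s g t ⟩
      t ℕ.* s ℕ.* g       ∎)))
  }
  where
  open ≡-Reasoning
  instance
    k≢0 : ℕ.NonZero k
    k≢0 = ℕ.>-nonZero (ℕ.≤-<-trans ℕ.z≤n q<k)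
    g≢0 : ℕ.NonZero (gcd k q)
    g≢0 = ℕ.≢-nonZero (gcd[m,n]≢0 k q (inj₁ (ℕ.≢-nonZero⁻¹ k)))
  g = gcd k q
  r = q ℕ./ g
  s = k ℕ./ g
  rg : r ℕ.* g ≡ q
  rg = ℕ.m/n*n≡m (gcd[m,n]∣n k q)
  sg : s ℕ.* g ≡ k
  sg = ℕ.m/n*n≡m (gcd[m,n]∣m k q)
  swap : ∀ s g r → s ℕ.* g ℕ.* r ≡ s ℕ.* (r ℕ.* g)
  swap = ℕ.solve-∀
  swap′ : ∀ r n g → r ℕ.* n ℕ.* g ≡ n ℕ.* (r ℕ.* g)
  swap′ = ℕ.solve-∀
  swap″ : ∀ s g t → s ℕ.* g ℕ.* t ≡ t ℕ.* s ℕ.* g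
  swap″ = ℕ.solve-∀

-i≤∣i∣ : ∀ i → - i ≤ + ℤ.∣ i ∣
-i≤∣i∣ (+ m)    = ℤ.neg-≤-pos
-i≤∣i∣ -[1+ m ] = ℤ.≤-refl

i≤∣i∣ : ∀ i → i ≤ + ℤ.∣ i ∣
i≤∣i∣ i = subst₂ _≤_ (ℤ.neg-involutive i) (cong +_ (ℤ.∣-i∣≡∣i∣ i)) (-i≤∣i∣ (- i))

∣v∣≤supNorm : ∀ {n} k (v : Subset n → ℤ) p → ∣ p ∣ ≡ k → ℤ.∣ v p ∣ ℕ.≤ supNorm n k v
∣v∣≤supNorm k v p ∣p∣ = go (kSubsets _ k) (∈-kSubsets k p ∣p∣)
  where
  go : ∀ xs → p ∈ xs → ℤ.∣ v p ∣ ℕ.≤ foldr ℕ._⊔_ 0 (map (λ q → ℤ.∣ v q ∣) xs)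
  go (x ∷ xs) (here refl) = ℕ.m≤m⊔n ℤ.∣ v p ∣ _
  go (x ∷ xs) (there p∈)  = ℕ.≤-trans (go xs p∈) (ℕ.m≤n⊔m ℤ.∣ v x ∣ _)

+≢- : ∀ {a b} → b ≢ 0 → + a ≢ - + b
+≢- {b = zero}  b≢0 _ = b≢0 refl
+≢- {b = suc b} _   ()

module _ {n k q a b : ℕ} (c : Vec ℤ n) (v : Subset n → ℤ) (q<k : q ℕ.< k)
         (values : ∀ p → ∣ p ∣ ≡ k → v p ≡ + q + σ c p) (nonzero : ∀ p → ∣ p ∣ ≡ k → v p ≢ + 0)
         (k≤occ-a : k ℕ.≤ occ (+ a) c) (k≤occ-b : k ℕ.≤ occ (- + b) c) (b≢0 : b ≢ 0) where

  -- The extreme mixtures give k a + q and q - k b, which bound the norm by the two entries of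
  -- `valB`; the mixtures in between are used to detect zeros.
  attained : ∀ i j → i ℕ.+ j ≡ k → ∃ λ p → ∣ p ∣ ≡ k × v p ≡ + (q ℕ.+ i ℕ.* a) - + (j ℕ.* b)
  attained i j i+j≡k with p , ∣p∣ , eq ← choose c (+≢- b≢0) i j
      (ℕ.≤-trans (ℕ.m+n≤o⇒m≤o i (ℕ.≤-reflexive i+j≡k)) k≤occ-a)
      (ℕ.≤-trans (ℕ.m+n≤o⇒n≤o i (ℕ.≤-reflexive i+j≡k)) k≤occ-b) =
    p , trans ∣p∣ i+j≡k , (begin
      v p                                    ≡⟨ values p (trans ∣p∣ i+j≡k) ⟩
      + q + σ c p                            ≡⟨ cong (_+_ (+ q)) eq ⟩
      + q + (+ i * + a + + j * - + b)        ≡⟨ shuffle (+ q) (+ i) (+ a) (+ j) (+ b) ⟩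
      + q + + i * + a - + j * + b            ≡⟨ cong₂ (λ x y → + q + x - y) (ℤ.pos-* i a) (ℤ.pos-* j b) ⟨
      + (q ℕ.+ i ℕ.* a) - + (j ℕ.* b)        ∎)
    where
    open ≡-Reasoning
    shuffle : ∀ q i a j b → q + (i * a + j * - b) ≡ q + i * a - j * b
    shuffle = solve-∀

  norm-a : k ℕ.* a ℕ.+ q ℕ.≤ supNorm n k v
  norm-a with p , ∣p∣ , eq ← attained k 0 (ℕ.+-identityʳ k) = subst (ℕ._≤ supNorm n k v)
    (trans (cong ℤ.∣_∣ {v p} {+ (q ℕ.+ k ℕ.* a)} (trans eq (ℤ.+-identityʳ _))) (ℕ.+-comm q (k ℕ.* a))) (∣v∣≤supNorm k v p ∣p∣)

  norm-b : k ℕ.* b ℕ.≤ supNorm n k v ℕ.+ q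
  norm-b with p , ∣p∣ , eq ← attained 0 k refl = ℤ.drop‿+≤+ (ℤ.≤-trans
    (ℤ.≤-reflexive (trans (shuffle (+ (q ℕ.+ 0)) (+ (k ℕ.* b))) (cong₂ (λ x y → - x + + y) (sym eq) (ℕ.+-identityʳ q))))
    (ℤ.+-monoˡ-≤ (+ q) (ℤ.≤-trans (-i≤∣i∣ (v p)) (+≤+ (∣v∣≤supNorm k v p ∣p∣)))))
    where
    shuffle : ∀ x y → y ≡ - (x - y) + x
    shuffle = solve-∀

  -- The mixture with X points of slope a has value q + X (a + b) - b k, so the equation would make
  -- it a zero of v. It also gives X (a + b) ≤ k (a + b), which ensures that at most k points are
  -- asked for.
  ∤-bound : ∀ X → b ℕ.* k ≢ q ℕ.+ X ℕ.* (a ℕ.+ b)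
  ∤-bound X eq = vanish (ℕ.m≤n⇒∃[o]m+o≡n X≤k)
    where
    instance
      a+b≢0 : ℕ.NonZero (a ℕ.+ b)
      a+b≢0 = ℕ.≢-nonZero (λ z → b≢0 (ℕ.m+n≡0⇒n≡0 a z))
    X≤k : X ℕ.≤ k
    X≤k = ℕ.*-cancelʳ-≤ X k (a ℕ.+ b) (begin
      X ℕ.* (a ℕ.+ b)          ≤⟨ ℕ.m≤n+m _ q ⟩
      q ℕ.+ X ℕ.* (a ℕ.+ b)    ≡⟨ eq ⟨
      b ℕ.* k                  ≡⟨ ℕ.*-comm b k ⟩
      k ℕ.* b                  ≤⟨ ℕ.*-monoʳ-≤ k (ℕ.m≤n+m b a) ⟩
      k ℕ.* (a ℕ.+ b)          ∎)
      where open ℕ.≤-Reasoning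
    vanish : (∃ λ j → X ℕ.+ j ≡ k) → ⊥
    vanish (j , X+j≡k) with p , ∣p∣ , veq ← attained X j X+j≡k =
      nonzero p ∣p∣ (trans veq (trans (cong (λ z → + z - + (j ℕ.* b)) jb≡) (ℤ.+-inverseʳ (+ (j ℕ.* b)))))
      where
      split₁ : ∀ q X a b → q ℕ.+ X ℕ.* (a ℕ.+ b) ≡ q ℕ.+ X ℕ.* a ℕ.+ X ℕ.* b
      split₁ = ℕ.solve-∀
      split₂ : ∀ X j b → b ℕ.* (X ℕ.+ j) ≡ j ℕ.* b ℕ.+ X ℕ.* b
      split₂ = ℕ.solve-∀
      jb≡ : q ℕ.+ X ℕ.* a ≡ j ℕ.* b
      jb≡ = ℕ.+-cancelʳ-≡ (X ℕ.* b) _ _ (trans (sym (split₁ q X a b))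
        (trans (sym eq) (trans (cong (b ℕ.*_) (sym X+j≡k)) (split₂ X j b))))

  -- As r k = s q, the numerator (b s - r) k equals s (b k - q). After cancelling s, integrality
  -- says that a + b divides b k - q, which the absence of zeros forbids.
  lowest-InB : (balanced : + n * + q + + k * σ c full ≡ 0ℤ) (lt : LowestTerms k q) →
               InB n k a b (LowestTerms.r lt) (LowestTerms.s lt)
  lowest-InB balanced lt = b≢0 , r<s , gcd≡1 , gcd-greatest (s∣n n ℤ.∣ σ c full ∣ nq≡) s∣k , no-div
    where
    open LowestTerms lt
    instance
      s≢0 : ℕ.NonZero s
      s≢0 = ℕ.>-nonZero (ℕ.≤-<-trans ℕ.z≤n r<s)
    nq≡ : n ℕ.* q ≡ k ℕ.* ℤ.∣ σ c full ∣
    nq≡ = begin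
      n ℕ.* q                       ≡⟨ ℤ.abs-* (+ n) (+ q) ⟨
      ℤ.∣ + n * + q ∣               ≡⟨ cong ℤ.∣_∣ {+ n * + q} {y = - (+ k * σ c full)} nq≡-kσ ⟩
      ℤ.∣ - (+ k * σ c full) ∣      ≡⟨ ℤ.∣-i∣≡∣i∣ (+ k * σ c full) ⟩
      ℤ.∣ + k * σ c full ∣          ≡⟨ ℤ.abs-* (+ k) (σ c full) ⟩
      k ℕ.* ℤ.∣ σ c full ∣          ∎
      where
      open ≡-Reasoning
      shuffle : ∀ x y → 0ℤ - (x + y) ≡ - y - x
      shuffle = solve-∀
      nq≡-kσ : + n * + q ≡ - (+ k * σ c full)
      nq≡-kσ = ≡-transfer balanced (shuffle (+ n * + q) (+ k * σ c full))
    bsk≡ : b ℕ.* s ℕ.* k ≡ s ℕ.* (b ℕ.* k)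
    bsk≡ = regroup b s k
      where
      regroup : ∀ b s k → b ℕ.* s ℕ.* k ≡ s ℕ.* (b ℕ.* k)
      regroup = ℕ.solve-∀
    q≤bk : q ℕ.≤ b ℕ.* k
    q≤bk = ℕ.≤-trans (ℕ.<⇒≤ q<k) (ℕ.m≤n*m k b {{ℕ.≢-nonZero b≢0}})
    numerator : (b ℕ.* s ∸ r) ℕ.* k ≡ s ℕ.* (b ℕ.* k ∸ q)
    numerator = begin
      (b ℕ.* s ∸ r) ℕ.* k             ≡⟨ ℕ.*-distribʳ-∸ k (b ℕ.* s) r ⟩
      b ℕ.* s ℕ.* k ∸ r ℕ.* k         ≡⟨ cong₂ _∸_ bsk≡ (trans (ℕ.*-comm r k) cross) ⟩
      s ℕ.* (b ℕ.* k) ∸ s ℕ.* q       ≡⟨ ℕ.*-distribˡ-∸ s (b ℕ.* k) q ⟨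
      s ℕ.* (b ℕ.* k ∸ q)             ∎
      where open ≡-Reasoning
    no-div : ¬ (s ℕ.* (a ℕ.+ b) ∣ (b ℕ.* s ∸ r) ℕ.* k)
    no-div (divides X eq) = ∤-bound X (trans (sym (ℕ.m+[n∸m]≡n q≤bk))
      (cong (q ℕ.+_) (ℕ.*-cancelˡ-≡ _ _ s (trans (sym numerator) (trans eq (regroup X s (a ℕ.+ b)))))))
      where
      regroup : ∀ X s d → X ℕ.* (s ℕ.* d) ≡ s ℕ.* (X ℕ.* d)
      regroup = ℕ.solve-∀

  frequent⇒valB≤supNorm : + n * + q + + k * σ c full ≡ 0ℤ →
    ∃₂ λ r s → InB n k a b r s × valB k a b r s ℚ.≤ ℕtoℚ (supNorm n k v)
  frequent⇒valB≤supNorm balanced = r , s , lowest-InB balanced lt ,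
    valB-≤ k a b r s q (supNorm n k v) (ℕ.≤-<-trans ℕ.z≤n r<s) cross norm-a norm-b
    where
    lt = lowest-terms q<k
    open LowestTerms lt using (r; s; r<s; cross)

-- The two ranges of the norm

normal-form : ∀ {n k v} → 1 ℕ.≤ k → k ℕ.< n → IsNZIθ₁Eigenvector n k v → Normal n k v
-- k < n writes n as 2 + k′ + e′ with e′ = n - k - 1, so that θ₁ becomes k′ e′ - 1.
normal-form {k = suc k′} {v} _ k<n (_ , eigen) with e′ , refl ← ℕ.m≤n⇒∃[o]m+o≡n k<n =
  normalise (affine-eigenvector refl v (λ p ∣p∣ → trans
    (cong (λ xs → ∑ xs v) (sym (meeting-adj p k′ ∣p∣)))
    (trans (eigen p ∣p∣) (cong (_* v p) (θ₁-≡ k′ e′)))))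

small-norm : ∀ {n k γ N v} (w : Witness k γ) → 1 ℕ.≤ k → k ℕ.< n → T k γ ℚ.< ℕtoℚ n → IsMinN n k N →
  Normal n k v → (∀ p → ∣ p ∣ ≡ k → v p ≢ + 0) → supNorm n k v ℕ.< k ℕ.* Witness.M w →
  N ℚ.≤ ℕtoℚ (supNorm n k v)
small-norm {n} {suc k′} {γ} {N} {v} w 1≤k k<n T<n (_ , minimal) (normal q q<k c values balanced) nonzero small =
  finish (frequent-value M c q<k (ℕ.<⇒≤ k<n) balanced upper large)
         (frequent-negative M c q<k (ℕ.<⇒≤ k<n) balanced lower large)
  where
  open Witness w using (M; 2kM≤j)
  large = T-large {n} {k′} {M} γ 2kM≤j T<n
  upper : ∀ p → ∣ p ∣ ≡ suc k′ → + q + σ c p < + (suc k′ ℕ.* M)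
  upper p ∣p∣ = subst (_< _) (values p ∣p∣) (ℤ.≤-<-trans (i≤∣i∣ (v p))
    (+<+ (ℕ.≤-<-trans (∣v∣≤supNorm (suc k′) v p ∣p∣) small)))
  lower : ∀ p → ∣ p ∣ ≡ suc k′ → - (+ q + σ c p) < + (suc k′ ℕ.* M)
  lower p ∣p∣ = subst (λ z → - z < _) (values p ∣p∣) (ℤ.≤-<-trans (-i≤∣i∣ (v p))
    (+<+ (ℕ.≤-<-trans (∣v∣≤supNorm (suc k′) v p ∣p∣) small)))
  negative-nonzero : ∀ {b} → suc k′ ℕ.≤ occ (- + b) c → q ≡ 0 ⊎ b ≢ 0 → b ≢ 0
  negative-nonzero _ (inj₂ b≢0) = b≢0
  -- If q = b = 0, then k points of slope 0 form a set on which v is 0. The second slope given to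
  -- `choose` is a dummy, taken zero times.
  negative-nonzero k≤occ-b (inj₁ q≡0) refl
    with p , ∣p∣ , σ≡ ← choose c {0ℤ} {1ℤ} (λ ()) (suc k′) 0 k≤occ-b ℕ.z≤n =
    nonzero p ∣p∣′ (trans (values p ∣p∣′)
      (cong₂ (λ x y → + x + y) q≡0 (trans σ≡ (cong (_+ 0ℤ) (ℤ.*-zeroʳ (+ suc k′))))))
    where
    ∣p∣′ : ∣ p ∣ ≡ suc k′
    ∣p∣′ = trans ∣p∣ (ℕ.+-identityʳ (suc k′))
  finish : (∃ λ a → suc k′ ℕ.≤ occ (+ a) c) → (∃ λ b → (suc k′ ℕ.≤ occ (- + b) c) × (q ≡ 0 ⊎ b ≢ 0)) →
           N ℚ.≤ ℕtoℚ (supNorm n (suc k′) v)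
  finish (a , k≤occ-a) (b , k≤occ-b , q≡0⊎b≢0)
    with r , s , inB , val≤ ← frequent⇒valB≤supNorm {b = b} c v q<k values nonzero k≤occ-a k≤occ-b
           (negative-nonzero k≤occ-b q≡0⊎b≢0) balanced =
    ℚ.≤-trans (minimal a b r s inB) val≤

theorem4 : (n k γ : ℕ) → 1 ℕ.≤ k → k ℕ.< n → IsLeastNonDivisor k γ →
    T k γ ℚ.< ℕtoℚ n →
    (N : ℚ) → IsMinN n k N →
    (v : Subset n → ℤ) → IsNZIθ₁Eigenvector n k v →
    N ℚ.+ ℚ.1ℚ ℚ.≤ ℕtoℚ (supNorm n k v) ℚ.+ ℚ.1ℚ
theorem4 n k γ 1≤k k<n least T<n N min@(_ , minimal) v nzi = ℚ.+-monoˡ-≤ ℚ.1ℚ (by-norm (ℕ.<-≤-connex (supNorm n k v) (k ℕ.* M)))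
  where
  w : Witness k γ
  w = witness-exists k γ least
  open Witness w using (M; a; b; a≤M; b≤M)
  by-norm : supNorm n k v ℕ.< k ℕ.* M ⊎ k ℕ.* M ℕ.≤ supNorm n k v → N ℚ.≤ ℕtoℚ (supNorm n k v)
  by-norm (inj₁ small) = small-norm w 1≤k k<n T<n min (normal-form 1≤k k<n nzi) (proj₁ nzi) small
  by-norm (inj₂ large) = ℚ.≤-trans (minimal a b 0 1 (witness-InB n w))
    (valB-≤ k a b 0 1 0 (supNorm n k v) (ℕ.s≤s ℕ.z≤n) (ℕ.*-zeroʳ k)
      (ℕ.≤-trans (ℕ.≤-reflexive (ℕ.+-identityʳ (k ℕ.* a))) (bound a≤M))
      (ℕ.≤-trans (bound b≤M) (ℕ.m≤m+n (supNorm n k v) 0)))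
    where
    bound : ∀ {x} → x ℕ.≤ M → k ℕ.* x ℕ.≤ supNorm n k v
    bound x≤M = ℕ.≤-trans (ℕ.*-monoʳ-≤ k x≤M) large
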